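{- Let $n\geq 3$ and $q=p^h$. If $c$ is a codeword of minimum weight of $C(PG(n,q))^\perp$, then $supp(c)$ is contained in a plane of $PG(n,q)$.
   Context: $C(PG(n,q))$ is the $\mathbb{F}_p$-span of the incidence vectors of the hyperplanes of $PG(n,q)$, with coordinates indexed by points. $C^\perp$ is its dual with respect to the standard scalar product over $\mathbb{F}_p$. $supp(c)$ is the set of points at which $c$ is nonzero. -}

module Defs where

open import Level using (Level; _⊔_) renaming (suc to lsuc)
open import Algebra.Bundles using (CommutativeRing)
open import Algebra.Apartness.Bundles using (HeytingField; HeytingCommutativeRing)
import Algebra.Properties.Monoid.Sum as MonoidSum
import Algebra.Properties.Semiring.Sum as SemiringSum
open import Data.Bool.Base using (if_then_else_)
open import Data.Fin.Base using (Fin; finToFun; funToFin)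
open import Data.Fin.Properties using (_≟_; any?; all?; finToFun-funToFin)
open import Data.List.Base as List using (List; allFin; filter; mapMaybe; deduplicate; length)
open import Data.Maybe.Base using (Maybe) renaming (map to mapᴹ)
open import Data.Nat.Base using (ℕ; suc; _^_; _≤_)
open import Data.Product.Base using (Σ; ∃; ∃-syntax; _,_; proj₁; proj₂)
open import Data.Vec.Functional using (Vector)
open import Function.Base using (_∘_)
open import Function.Bundles using (Inverse; Func; _⟶ₛ_; mk⇔)
open import Function.Properties.Inverse using (Inverse⇒Injection)
open import Relation.Binary.Bundles using (Setoid)
open import Relation.Binary.Definitions using (Decidable)
import Relation.Binary.PropositionalEquality as ≡
open ≡ using (_≡_)
open import Relation.Nullary.Decidable
  using (Dec; does; map′; ¬?; dec⇒maybe; does-⇔; via-injection; decidable-stable)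
open import Relation.Nullary.Negation using (¬_)

-- A finite field with exactly q elements.  Finiteness makes equality
-- decidable, so the (tight) apartness of the Heyting field is just _≉_.
record FiniteField (c ℓ₁ ℓ₂ : Level) (q : ℕ) : Set (lsuc (c ⊔ ℓ₁ ⊔ ℓ₂)) where
  field
    heytingField : HeytingField c ℓ₁ ℓ₂

  commutativeRing : CommutativeRing c ℓ₁
  commutativeRing =
    HeytingCommutativeRing.commutativeRing (HeytingField.heytingCommutativeRing heytingField)

  open CommutativeRing commutativeRing public

  field
    enumeration : Inverse setoid (≡.setoid (Fin q))

  open MonoidSum +-monoid public using (sum)

  infix 4 _≈?_
  _≈?_ : Decidable _≈_
  _≈?_ = via-injection (Inverse⇒Injection enumeration) _≟_

  nthVector : ∀ {k} → Fin (q ^ k) → Vector Carrier k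
  nthVector i j = Inverse.from enumeration (finToFun i j)

  nthVector-surjective : ∀ {k} (v : Vector Carrier k) → ∃[ i ] ∀ j → nthVector i j ≈ v j
  nthVector-surjective v = funToFin (to ∘ v) , λ j →
    trans (from-cong (finToFun-funToFin (to ∘ v) j)) (strictlyInverseʳ (v j))
    where open Inverse enumeration

  ∃vector? : ∀ {k p} {P : Vector Carrier k → Set p} →
             (∀ {v w} → (∀ j → v j ≈ w j) → P v → P w) →
             (∀ v → Dec (P v)) → Dec (∃ P)
  ∃vector? resp P? = map′
    (λ (i , pi) → nthVector i , pi)
    (λ (v , pv) → let i , i≈v = nthVector-surjective v in i , resp (λ j → sym (i≈v j)) pv)
    (any? (P? ∘ nthVector))


module ProjectiveSpace {c ℓ₁ ℓ₂ q} (F : FiniteField c ℓ₁ ℓ₂ q) (n : ℕ) where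

  open FiniteField F
  private module Sum = SemiringSum semiring

  Coordinates : Set c
  Coordinates = Vector Carrier (suc n)

  infix 4 _≋_
  _≋_ : Coordinates → Coordinates → Set ℓ₁
  v ≋ w = ∀ i → v i ≈ w i

  _≋?_ : Decidable _≋_
  v ≋? w = all? (λ i → v i ≈? w i)

  0ᵛ : Coordinates
  0ᵛ _ = 0#

  infixr 7 _·_
  _·_ : Carrier → Coordinates → Coordinates
  (a · v) i = a * v i

  combination : ∀ {k} → Vector Carrier k → Vector Coordinates k → Coordinates
  combination a b i = sum (λ j → a j * b j i)

  combination-cong : ∀ {k} {a a′ : Vector Carrier k} (b : Vector Coordinates k) →
                     (∀ j → a j ≈ a′ j) → combination a b ≋ combination a′ b
  combination-cong b a≈a′ i = Sum.sum-cong-≋ (λ j → *-congʳ (a≈a′ j))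

  combination-· : ∀ {k} s (a : Vector Carrier k) (b : Vector Coordinates k) →
                  combination (λ j → s * a j) b ≋ s · combination a b
  combination-· s a b i = sym (trans
    (Sum.*-distribˡ-sum s (λ j → a j * b j i))
    (Sum.sum-cong-≋ (λ j → sym (*-assoc s (a j) (b j i)))))

  Point : Set (c ⊔ ℓ₁)
  Point = Σ Coordinates λ v → ¬ (v ≋ 0ᵛ)

  -- Homogeneous coordinates: the scalar is automatically nonzero, as Q is.
  infix 4 _∼_
  _∼_ : Point → Point → Set (c ⊔ ℓ₁)
  (v , _) ∼ (w , _) = ∃[ s ] s · v ≋ w

  ∼-refl : ∀ {P} → P ∼ P
  ∼-refl = 1# , λ i → *-identityˡ _

  ∼-trans : ∀ {P Q R} → P ∼ Q → Q ∼ R → P ∼ R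
  ∼-trans (s , sv≋w) (t , tw≋u) =
    t * s , λ i → trans (*-assoc t s _) (trans (*-congˡ (sv≋w i)) (tw≋u i))

  ∼-sym : ∀ {P Q} → P ∼ Q → Q ∼ P
  ∼-sym {v , _} {w , w≢0} (s , sv≋w) = s⁻¹ , λ i →
    trans (*-congˡ (sym (sv≋w i)))
      (trans (sym (*-assoc s⁻¹ s (v i)))
        (trans (*-congʳ s⁻¹s≈1) (*-identityˡ (v i))))
    where
    module H = HeytingField heytingField
    s≉0 : ¬ (s ≈ 0#)
    s≉0 s≈0 = w≢0 λ i → trans (sym (sv≋w i)) (trans (*-congʳ s≈0) (zeroˡ (v i)))
    inverse? : Dec (∃[ t ] t * s ≈ 1#)
    inverse? = map′
      (λ (i , p) → Inverse.from enumeration i , p)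
      (λ (t , p) → Inverse.to enumeration t ,
        trans (*-congʳ (Inverse.strictlyInverseʳ enumeration t)) p)
      (any? (λ i → Inverse.from enumeration i * s ≈? 1#))
    s-0≈s : s - 0# ≈ s
    s-0≈s = trans (+-congˡ (trans (sym (+-identityˡ (- 0#))) (-‿inverseʳ 0#))) (+-identityʳ s)
    inverse : ∃[ t ] t * s ≈ 1#
    inverse = decidable-stable inverse? λ none →
      s≉0 (proj₁ (H.tight s 0#) λ s#0 →
        let t , ts≈1 , _ = H.#⇒invertible s#0
        in none (t , trans (*-congˡ (sym s-0≈s)) ts≈1))
    s⁻¹ : Carrier
    s⁻¹ = proj₁ inverse
    s⁻¹s≈1 : s⁻¹ * s ≈ 1#
    s⁻¹s≈1 = proj₂ inverse

  pointSetoid : Setoid (c ⊔ ℓ₁) (c ⊔ ℓ₁)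
  pointSetoid = record
    { Carrier = Point
    ; _≈_ = _∼_
    ; isEquivalence = record
      { refl  = λ {P} → ∼-refl {P}
      ; sym   = λ {P} {Q} → ∼-sym {P} {Q}
      ; trans = λ {P} {Q} {R} → ∼-trans {P} {Q} {R}
      }
    }

  _∼?_ : Decidable _∼_
  (v , _) ∼? (w , _) = map′
    (λ (i , p) → Inverse.from enumeration i , p)
    (λ (s , p) → Inverse.to enumeration s ,
      λ i → trans (*-congʳ (Inverse.strictlyInverseʳ enumeration s)) (p i))
    (any? (λ i → (Inverse.from enumeration i · v) ≋? w))

  asPoint : Coordinates → Maybe Point
  asPoint v = mapᴹ (v ,_) (dec⇒maybe (¬? (v ≋? 0ᵛ)))

  -- One representative of every point.
  points : List Point
  points = deduplicate _∼?_ (mapMaybe (asPoint ∘ nthVector) (allFin (q ^ suc n)))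

  -- A k-dimensional vector subspace of F^(n+1), i.e. a (k-1)-dimensional
  -- projective subspace, given by a basis.
  record Subspace (k : ℕ) : Set (c ⊔ ℓ₁) where
    field
      basis       : Vector Coordinates k
      independent : ∀ a → combination a basis ≋ 0ᵛ → ∀ j → a j ≈ 0#

  Plane : Set (c ⊔ ℓ₁)
  Plane = Subspace 3

  Hyperplane : Set (c ⊔ ℓ₁)
  Hyperplane = Subspace n

  infix 4 _on_ _on?_
  _on_ : ∀ {k} → Point → Subspace k → Set (c ⊔ ℓ₁)
  (v , _) on U = ∃[ a ] combination a (Subspace.basis U) ≋ v

  _on?_ : ∀ {k} (P : Point) (U : Subspace k) → Dec (P on U)
  (v , _) on? U = ∃vector?
    (λ a≈a′ p i → trans (sym (combination-cong (Subspace.basis U) a≈a′ i)) (p i))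
    (λ a → combination a (Subspace.basis U) ≋? v)

  on-resp-∼ : ∀ {k P Q} (U : Subspace k) → P ∼ Q → P on U → Q on U
  on-resp-∼ U (s , sv≋w) (a , p) = (λ j → s * a j) , λ i →
    trans (combination-· s a (Subspace.basis U) i) (trans (*-congˡ (p i)) (sv≋w i))


-- Words have their coordinates indexed by the points of PG(n,q), for F of
-- order q, and their entries in the field K of order p.
module HyperplaneCode
  {c ℓ₁ ℓ₂ q} (F : FiniteField c ℓ₁ ℓ₂ q) (n : ℕ)
  {c′ ℓ₁′ ℓ₂′ p} (K : FiniteField c′ ℓ₁′ ℓ₂′ p) where

  open FiniteField K
  open ProjectiveSpace F n

  Word : Set (c ⊔ ℓ₁ ⊔ c′ ⊔ ℓ₁′)
  Word = pointSetoid ⟶ₛ setoid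

  open Func public using () renaming (to to infixl 20 _at_)

  scalarProduct : Word → Word → Carrier
  scalarProduct x y = sum (λ i → x at List.lookup points i * y at List.lookup points i)

  incidenceVector : Hyperplane → Word
  incidenceVector H = record
    { to   = λ P → if does (P on? H) then 1# else 0#
    ; cong = λ {P} {Q} P∼Q → reflexive (≡.cong (if_then 1# else 0#)
        (does-⇔ (mk⇔ (on-resp-∼ {P = P} {Q} H P∼Q)
                    (on-resp-∼ {P = Q} {P} H (∼-sym {P} {Q} P∼Q)))
               (P on? H) (Q on? H)))
    }

  -- C(PG(n,q)): the K-span of the incidence vectors of the hyperplanes.
  InCode : Word → Set (c ⊔ ℓ₁ ⊔ c′ ⊔ ℓ₁′)
  InCode x = ∃[ m ] Σ (Vector Carrier m) λ a → Σ (Vector Hyperplane m) λ H →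
    ∀ P → x at P ≈ sum (λ j → a j * incidenceVector (H j) at P)

  InDual : Word → Set (c ⊔ ℓ₁ ⊔ c′ ⊔ ℓ₁′)
  InDual x = ∀ y → InCode y → scalarProduct x y ≈ 0#

  infix 4 _∈supp_
  _∈supp_ : Point → Word → Set ℓ₁′
  P ∈supp x = ¬ (x at P ≈ 0#)

  weight : Word → ℕ
  weight x = length (filter (λ P → ¬? (x at P ≈? 0#)) points)

  NonZeroWord : Word → Set (c ⊔ ℓ₁ ⊔ ℓ₁′)
  NonZeroWord x = ¬ (∀ P → x at P ≈ 0#)

  record IsMinimumWeightDualCodeword (x : Word) : Set (c ⊔ ℓ₁ ⊔ c′ ⊔ ℓ₁′) where
    field
      inDual  : InDual x
      nonZero : NonZeroWord x
      minimal : ∀ y → InDual y → NonZeroWord y → weight x ≤ weight y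

{-# OPTIONS --safe #-}

-- Let S be the support of a minimum weight codeword c.  Projecting c from a
-- point R outside S gives a dual codeword again, whose weight is smaller than
-- that of c if R lies on a line through two points of S.  By minimality it is
-- then zero, so that no line through R meets S in a single point.  Hence, for
-- independent b₀, b₁, b₂ in S, every line through b₀ in their plane, other
-- than b₀b₁, contains a further point of S: if it meets b₁b₂ in a point of S
-- this is clear, and otherwise that point is such an R.  If S contained four
-- independent points, two planes through b₀b₁ would thus give 2q points of S
-- besides b₀, whereas the difference of two intersecting lines is a dual
-- codeword of weight at most 2q.

module Submission where

open import Defs
open import Algebra.Apartness.Bundles using (HeytingField)
import Algebra.Properties.CommutativeSemigroup
import Algebra.Properties.Monoid.Mult
import Algebra.Properties.Ring
import Algebra.Properties.Semiring.Sum
import Algebra.Solver.Ring.NaturalCoefficients.Default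
open import Data.Bool.Base using (if_then_else_)
open import Data.Fin.Base
  using (Fin; zero; suc; toℕ; fromℕ; punchIn; punchOut; splitAt; join; _↑ˡ_; funToFin; finToFun; combine)
open import Data.Fin.Patterns using (0F; 1F; 2F; 3F)
open import Data.Fin.Permutation using (Permutation′; permutation)
import Data.Fin.Properties as Fin
open import Data.List.Base as List using (List; length; allFin)
import Data.List.Membership.Propositional.Properties as List∈
import Data.List.Membership.Setoid as Membership
import Data.List.Membership.Setoid.Properties as ∈Properties
import Data.List.Relation.Unary.All as All
import Data.List.Relation.Unary.AllPairs as AllPairs
import Data.List.Relation.Unary.AllPairs.Properties as AllPairsₚ
open import Data.List.Relation.Unary.Any using (index)
import Data.List.Relation.Unary.Any.Properties as Any
import Data.List.Relation.Unary.Unique.DecSetoid.Properties as DecUnique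
import Data.List.Relation.Unary.Unique.Setoid as Unique
import Data.Maybe.Relation.Unary.Any as Maybe
open import Data.Nat using (ℕ; zero; suc; _≤_; _<_; _^_; z≤n; s≤s)
import Data.Nat as ℕ
open import Data.Nat.Primality using (Prime)
import Data.Nat.Properties as ℕ
open import Data.Product using (Σ; ∃; ∃-syntax; _×_; _,_; proj₁; proj₂)
open import Data.Sum using (_⊎_; inj₁; inj₂; [_,_]′)
import Data.Sum as Sum using (map)
open import Data.Vec.Functional using (Vector; []; _∷_; replicate)
open import Function.Base using (_∘_; id; const)
open import Function.Bundles using (Func; Inverse; mk⇔)
open import Level using (Level; _⊔_)
open import Relation.Binary.Bundles using (Setoid; DecSetoid)
import Relation.Binary.PropositionalEquality as ≡
open ≡ using (_≡_; _≗_)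
import Relation.Binary.Reasoning.Setoid as SetoidReasoning
open import Relation.Nullary.Decidable
  using (Dec; does; yes; no; map′; ¬?; _×-dec_; decidable-stable; dec-true; dec-false; does-⇔)
open import Relation.Nullary.Negation using (¬_; contradiction)

-- The projected word has at each point the sum of the entries of c over the line joining that point
-- to R. A linear form at an image point equals its pullback at the original point, which reduces
-- the duality of the projected word to that of c. The pullback can be the zero form, however, so
-- one also needs that the entries of c sum to zero. This holds because the hyperplanes of a pencil
-- cover each point once modulo p. Two points of S on a line through R have the same image, whence
-- the drop in weight. If a line through R met S in a single point, the entry of c there would
-- survive in the projected word. The congruence q + 1 = 1 modulo p also says that every hyperplane
-- meets every line in 1 point modulo p. So the difference of two lines is dual; their common point
-- cancels, which leaves 2q points. On the other side, the q lines through b₀ other than b₀b₁ in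
-- each of the two planes share only b₀. The further points of S on them are therefore distinct, and
-- b₀ itself tips the balance.

funToFin-cong : ∀ {m n} {f g : Fin m → Fin n} → f ≗ g → funToFin f ≡ funToFin g
funToFin-cong {zero}  f≗g = ≡.refl
funToFin-cong {suc m} f≗g = ≡.cong₂ combine (f≗g zero) (funToFin-cong (f≗g ∘ suc))

-- Finite fields: inverses, characteristic, linear systems, indicators.

module FieldProperties {c ℓ₁ ℓ₂ q} (F : FiniteField c ℓ₁ ℓ₂ q) where

  open FiniteField F
  open Inverse enumeration using (to; from; to-cong; strictlyInverseˡ; strictlyInverseʳ)
  open Algebra.Properties.Ring ring public
  open Algebra.Properties.Semiring.Sum semiring public hiding (sum)
  open Algebra.Properties.Monoid.Mult +-monoid using (×-congʳ; ×-assocˡ) renaming (_×_ to _×′_)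
  open Algebra.Properties.CommutativeSemigroup *-commutativeSemigroup public
    using () renaming (x∙yz≈y∙xz to x*yz≈y*xz)
  module Solver = Algebra.Solver.Ring.NaturalCoefficients.Default commutativeSemiring
  open SetoidReasoning setoid
  private module H = HeytingField heytingField

  infix 4 _≉0
  _≉0 : Carrier → Set ℓ₁
  x ≉0 = ¬ (x ≈ 0#)

  -- In the zero ring the difference of `0#` with itself would be invertible, making `0#` apart from
  -- itself.
  1≉0 : 1# ≉0
  1≉0 1≈0 = H.#-irrefl refl
    (H.invertible⇒# {0#} {0#} (0# , all _ , all _))
    where
    all : ∀ x → x ≈ 1#
    all x = begin
      x       ≈⟨ *-identityʳ x ⟨
      x * 1#  ≈⟨ *-congˡ 1≈0 ⟩
      x * 0#  ≈⟨ zeroʳ x ⟩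
      0#      ≈⟨ 1≈0 ⟨
      1#      ∎

  opaque
    -- Tightness of the apartness only refutes that no inverse exists. Searching the finite field
    -- for one is decidable, which removes the double negation.
    inverse : ∀ {x} → x ≉0 → ∃[ t ] t * x ≈ 1#
    inverse {x} x≉0 = decidable-stable inverse? λ none →
      x≉0 (proj₁ (H.tight x 0#) λ x#0 →
        let t , tx≈1 , _ = H.#⇒invertible x#0
        in none (t , trans (*-congˡ (sym x-0≈x)) tx≈1))
      where
      inverse? : Dec (∃[ t ] t * x ≈ 1#)
      inverse? = map′ (λ (i , p) → from i , p)
        (λ (t , p) → to t , trans (*-congʳ (strictlyInverseʳ t)) p)
        (Fin.any? (λ i → from i * x ≈? 1#))
      x-0≈x : x - 0# ≈ x
      x-0≈x = trans (+-congˡ -0#≈0#) (+-identityʳ x)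

  x*y≈0⇒y≈0 : ∀ {x y} → x ≉0 → x * y ≈ 0# → y ≈ 0#
  x*y≈0⇒y≈0 {x} {y} x≉0 xy≈0 = let t , tx≈1 = inverse x≉0 in begin
    y            ≈⟨ *-identityˡ y ⟨
    1# * y       ≈⟨ *-congʳ tx≈1 ⟨
    t * x * y    ≈⟨ *-assoc t x y ⟩
    t * (x * y)  ≈⟨ *-congˡ xy≈0 ⟩
    t * 0#       ≈⟨ zeroʳ t ⟩
    0#           ∎

  *-cancelʳ : ∀ {x y z} → z ≉0 → x * z ≈ y * z → x ≈ y
  *-cancelʳ {x} {y} {z} z≉0 xz≈yz = x∙y⁻¹≈ε⇒x≈y x y (x*y≈0⇒y≈0 z≉0 (begin
    z * (x - y)    ≈⟨ *-comm z (x - y) ⟩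
    (x - y) * z    ≈⟨ [y-z]x≈yx-zx z x y ⟩
    x * z - y * z  ≈⟨ x≈y⇒x∙y⁻¹≈ε xz≈yz ⟩
    0#             ∎))

  1<q : 1 < q
  1<q = two (to 0#) (to 1#) λ eq → 1≉0 (begin
    1#            ≈⟨ strictlyInverseʳ 1# ⟨
    from (to 1#)  ≡⟨ ≡.cong from eq ⟨
    from (to 0#)  ≈⟨ strictlyInverseʳ 0# ⟩
    0#            ∎)
    where
    two : ∀ {m} (i j : Fin m) → ¬ i ≡ j → 1 < m
    two {suc zero}    zero zero i≢j = contradiction ≡.refl i≢j
    two {suc (suc m)} _    _    _   = s≤s (s≤s z≤n)

  nthVector-injective : ∀ {k} (i j : Fin (q ^ k)) → (∀ r → nthVector i r ≈ nthVector j r) → i ≡ j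
  nthVector-injective {k} i j eq =
    ≡.trans (≡.sym (Fin.funToFin-finToFin {k} i))
      (≡.trans (funToFin-cong same) (Fin.funToFin-finToFin {k} j))
    where
    same : finToFun {q} {k} i ≗ finToFun j
    same r = ≡.trans (≡.sym (strictlyInverseˡ _)) (≡.trans (to-cong (eq r)) (strictlyInverseˡ _))

  sum-zero : ∀ {k} {f : Vector Carrier k} → (∀ i → f i ≈ 0#) → sum f ≈ 0#
  sum-zero {k} f≈0 = trans (sum-cong-≋ f≈0) (sum-replicate-zero k)

  sum-neg : ∀ {k} (f : Vector Carrier k) → sum (λ i → - f i) ≈ - sum f
  sum-neg f = begin
    sum (λ i → - f i)       ≈⟨ sum-cong-≋ (λ i → -1*x≈-x (f i)) ⟨
    sum (λ i → - 1# * f i)  ≈⟨ *-distribˡ-sum (- 1#) f ⟨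
    - 1# * sum f            ≈⟨ -1*x≈-x (sum f) ⟩
    - sum f                 ∎

  sum-single : ∀ {k} (i : Fin k) (f : Vector Carrier k) → (∀ j → ¬ j ≡ i → f j ≈ 0#) → sum f ≈ f i
  sum-single {suc k} i f f≈0 = begin
    sum f                      ≈⟨ sum-remove f ⟩
    f i + sum (f ∘ punchIn i)  ≈⟨ +-congˡ (sum-zero (λ j → f≈0 (punchIn i j) (Fin.punchInᵢ≢i i j))) ⟩
    f i + 0#                   ≈⟨ +-identityʳ (f i) ⟩
    f i                        ∎

  sum-splitAt : ∀ m {n} (f : Fin m ⊎ Fin n → Carrier) →
                sum (f ∘ splitAt m {n}) ≈ sum (f ∘ inj₁) + sum (f ∘ inj₂)
  sum-splitAt zero    f = sym (+-identityˡ _)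
  sum-splitAt (suc m) f = trans (+-congˡ (sum-splitAt m (f ∘ Sum.map suc id))) (sym (+-assoc _ _ _))

  -- Adding 1 to every element permutes the field, hence leaves the sum of all
  -- elements unchanged.
  q×1≈0 : sum (replicate q 1#) ≈ 0#
  q×1≈0 = begin
    sum (replicate q 1#)                       ≈⟨ xyx⁻¹≈y (sum from) _ ⟨
    sum from + sum (replicate q 1#) - sum from ≈⟨ +-congʳ (∑-distrib-+ from (replicate q 1#)) ⟨
    sum (λ i → from i + 1#) - sum from         ≈⟨ +-congʳ (sum-cong-≋ (λ i → strictlyInverseʳ (from i + 1#))) ⟨
    sum (λ i → from (to (from i + 1#))) - sum from ≈⟨ +-congʳ (sum-permute from shift) ⟨
    sum from - sum from                        ≈⟨ -‿inverseʳ (sum from) ⟩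
    0#                                         ∎
    where
    cancel : ∀ {d e} → d + e ≈ 0# → ∀ i → to (from (to (from i + d)) + e) ≡ i
    cancel {d} {e} d+e≈0 i = ≡.trans (to-cong (begin
      from (to (from i + d)) + e  ≈⟨ +-congʳ (strictlyInverseʳ _) ⟩
      from i + d + e              ≈⟨ +-assoc _ d e ⟩
      from i + (d + e)            ≈⟨ +-congˡ d+e≈0 ⟩
      from i + 0#                 ≈⟨ +-identityʳ _ ⟩
      from i                      ∎)) (strictlyInverseˡ i)
    shift : Permutation′ q
    shift = permutation (λ i → to (from i + 1#)) (λ i → to (from i - 1#))
      (cancel (-‿inverseˡ 1#)) (cancel (-‿inverseʳ 1#))

  -- Applied to `K`, of order p, this turns q = p ^ h into q = 0 in `K`, on which all counting of
  -- points modulo p rests.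
  q^h×1≈0 : ∀ {h} → 1 ≤ h → sum (replicate (q ^ h) 1#) ≈ 0#
  q^h×1≈0 {suc h} _ = begin
    sum (replicate (q ^ suc h) 1#)  ≈⟨ sum-replicate (q ^ suc h) ⟩
    (q ℕ.* q ^ h) ×′ 1#             ≡⟨ ≡.cong (_×′ 1#) (ℕ.*-comm q (q ^ h)) ⟩
    (q ^ h ℕ.* q) ×′ 1#             ≈⟨ ×-assocˡ 1# (q ^ h) q ⟨
    (q ^ h) ×′ (q ×′ 1#)            ≈⟨ ×-congʳ (q ^ h) (trans (sym (sum-replicate q)) q×1≈0) ⟩
    (q ^ h) ×′ 0#                   ≈⟨ sum-replicate (q ^ h) ⟨
    sum (replicate (q ^ h) 0#)      ≈⟨ sum-replicate-zero (q ^ h) ⟩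
    0#                              ∎

  opaque
    -- Pigeonhole in place of elimination: the q ^ k coefficient vectors yield at most q ^ m tuples
    -- of values, so two of them agree, and their difference is a nontrivial solution.
    homogeneous-solution : ∀ {m k} → m < k → (M : Fin k → Fin m → Carrier) →
      Σ (Vector Carrier k) λ a → (∃[ j ] a j ≉0) × (∀ r → sum (λ j → a j * M j r) ≈ 0#)
    homogeneous-solution {m} {k} m<k M =
      let i , j , i<j , same = Fin.pigeonhole (ℕ.^-monoʳ-< q 1<q m<k) image
      in difference i j (Fin.<⇒≢ i<j) same
      where
      value : Fin (q ^ k) → Vector Carrier m
      value x r = sum (λ l → nthVector x l * M l r)
      image : Fin (q ^ k) → Fin (q ^ m)
      image x = funToFin (to ∘ value x)
      image≡⇒value≈ : ∀ i j → image i ≡ image j → ∀ r → value i r ≈ value j r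
      image≡⇒value≈ i j same r = begin
        value i r                    ≈⟨ strictlyInverseʳ _ ⟨
        from (to (value i r))        ≡⟨ ≡.cong from (Fin.finToFun-funToFin (to ∘ value i) r) ⟨
        from (finToFun (image i) r)  ≡⟨ ≡.cong (λ x → from (finToFun x r)) same ⟩
        from (finToFun (image j) r)  ≡⟨ ≡.cong from (Fin.finToFun-funToFin (to ∘ value j) r) ⟩
        from (to (value j r))        ≈⟨ strictlyInverseʳ _ ⟩
        value j r                    ∎
      difference : ∀ i j → ¬ i ≡ j → image i ≡ image j →
        Σ (Vector Carrier k) λ a → (∃[ l ] a l ≉0) × (∀ r → sum (λ l → a l * M l r) ≈ 0#)
      difference i j i≢j same =
        (λ l → nthVector i l - nthVector j l) ,
        Fin.¬∀⟶∃¬ k _ (λ l → _ ≈? 0#)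
          (λ all → i≢j (nthVector-injective i j (λ l → x∙y⁻¹≈ε⇒x≈y _ _ (all l)))) ,
        λ r → begin
          sum (λ l → (nthVector i l - nthVector j l) * M l r)
            ≈⟨ sum-cong-≋ (λ l → [y-z]x≈yx-zx (M l r) (nthVector i l) (nthVector j l)) ⟩
          sum (λ l → nthVector i l * M l r - nthVector j l * M l r)
            ≈⟨ ∑-distrib-+ (λ l → nthVector i l * M l r) _ ⟩
          value i r + sum (λ l → - (nthVector j l * M l r))
            ≈⟨ +-congˡ (sum-neg (λ l → nthVector j l * M l r)) ⟩
          value i r - value j r
            ≈⟨ x≈y⇒x∙y⁻¹≈ε (image≡⇒value≈ i j same r) ⟩
          0# ∎

  -- Written with `if does` exactly as the entries of `incidenceVector`, which are thus instances by
  -- definition.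
  𝟙 : ∀ {a} {A : Set a} → Dec A → Carrier
  𝟙 d = if does d then 1# else 0#

  𝟙-yes : ∀ {a} {A : Set a} (d : Dec A) → A → 𝟙 d ≈ 1#
  𝟙-yes d a = reflexive (≡.cong (if_then 1# else 0#) (dec-true d a))

  𝟙-no : ∀ {a} {A : Set a} (d : Dec A) → ¬ A → 𝟙 d ≈ 0#
  𝟙-no d ¬a = reflexive (≡.cong (if_then 1# else 0#) (dec-false d ¬a))

  𝟙-cong : ∀ {a b} {A : Set a} {B : Set b} (d : Dec A) (e : Dec B) →
           (A → B) → (B → A) → 𝟙 d ≈ 𝟙 e
  𝟙-cong d e f g = reflexive (≡.cong (if_then 1# else 0#) (does-⇔ (mk⇔ f g) d e))

  sum-𝟙-unique : ∀ {k a} {A : Fin k → Set a} (A? : ∀ i → Dec (A i)) (f : Vector Carrier k)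
                 (i : Fin k) → A i → (∀ j → A j → j ≡ i) → sum (λ j → f j * 𝟙 (A? j)) ≈ f i
  sum-𝟙-unique A? f i Ai unique = begin
    sum (λ j → f j * 𝟙 (A? j))  ≈⟨ sum-single i _ (λ j j≢i →
                                     trans (*-congˡ (𝟙-no (A? j) (j≢i ∘ unique j))) (zeroʳ (f j))) ⟩
    f i * 𝟙 (A? i)              ≈⟨ *-congˡ (𝟙-yes (A? i) Ai) ⟩
    f i * 1#                    ≈⟨ *-identityʳ (f i) ⟩
    f i                         ∎

-- Linear forms, independence, and hyperplanes as kernels.

module LinearAlgebra {c ℓ₁ ℓ₂ q} (F : FiniteField c ℓ₁ ℓ₂ q) (n : ℕ) where

  open FiniteField F hiding (zero)
  open FieldProperties F
  open ProjectiveSpace F n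
  open SetoidReasoning setoid

  ⟨_,_⟩ : Coordinates → Coordinates → Carrier
  ⟨ g , v ⟩ = sum (λ i → g i * v i)

  infixl 6 _+[_]_
  _+[_]_ : Coordinates → Carrier → Coordinates → Coordinates
  (v +[ s ] w) i = v i + s * w i

  +[]-cong : ∀ {v v′ w w′} s → v ≋ v′ → w ≋ w′ → v +[ s ] w ≋ v′ +[ s ] w′
  +[]-cong s v≋v′ w≋w′ i = +-cong (v≋v′ i) (*-congˡ (w≋w′ i))

  +[]-zeroˡ : ∀ {v s w} → s ≈ 0# → v +[ s ] w ≋ v
  +[]-zeroˡ {v} {s} {w} s≈0 i = trans (+-congˡ (trans (*-congʳ s≈0) (zeroˡ (w i)))) (+-identityʳ (v i))

  0·+[1]-identity : ∀ {v w} → 0# · v +[ 1# ] w ≋ w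
  0·+[1]-identity {v} {w} i = trans (+-cong (zeroˡ (v i)) (*-identityˡ (w i))) (+-identityˡ (w i))

  ⟨⟩-congˡ : ∀ g {v w} → v ≋ w → ⟨ g , v ⟩ ≈ ⟨ g , w ⟩
  ⟨⟩-congˡ g v≋w = sum-cong-≋ (λ i → *-congˡ {g i} (v≋w i))

  ⟨⟩-0ᵛ : ∀ g {v} → v ≋ 0ᵛ → ⟨ g , v ⟩ ≈ 0#
  ⟨⟩-0ᵛ g v≋0 = sum-zero (λ i → trans (*-congˡ (v≋0 i)) (zeroʳ (g i)))

  ⟨⟩-comm : ∀ g v → ⟨ g , v ⟩ ≈ ⟨ v , g ⟩
  ⟨⟩-comm g v = sum-cong-≋ (λ i → *-comm (g i) (v i))

  ⟨⟩-+[] : ∀ g v s w → ⟨ g , v +[ s ] w ⟩ ≈ ⟨ g , v ⟩ + s * ⟨ g , w ⟩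
  ⟨⟩-+[] g v s w = begin
    sum (λ i → g i * (v i + s * w i))           ≈⟨ sum-cong-≋ (λ i → distribute (g i) (v i) (w i)) ⟩
    sum (λ i → g i * v i + s * (g i * w i))     ≈⟨ ∑-distrib-+ (λ i → g i * v i) (λ i → s * (g i * w i)) ⟩
    ⟨ g , v ⟩ + sum (λ i → s * (g i * w i))     ≈⟨ +-congˡ (*-distribˡ-sum s (λ i → g i * w i)) ⟨
    ⟨ g , v ⟩ + s * ⟨ g , w ⟩                   ∎
    where
    distribute : ∀ x y z → x * (y + s * z) ≈ x * y + s * (x * z)
    distribute x y z = solve 4 (λ x y z s → x :* (y :+ s :* z) := x :* y :+ s :* (x :* z)) refl x y z s
      where open Solver

  ⟨⟩-· : ∀ g s v → ⟨ g , s · v ⟩ ≈ s * ⟨ g , v ⟩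
  ⟨⟩-· g s v = begin
    sum (λ i → g i * (s * v i))  ≈⟨ sum-cong-≋ (λ i → x*yz≈y*xz (g i) s (v i)) ⟩
    sum (λ i → s * (g i * v i))  ≈⟨ *-distribˡ-sum s (λ i → g i * v i) ⟨
    s * ⟨ g , v ⟩                ∎

  ⟨⟩-combination : ∀ {k} g (a : Vector Carrier k) b →
                   ⟨ g , combination a b ⟩ ≈ sum (λ j → a j * ⟨ g , b j ⟩)
  ⟨⟩-combination {zero}  g a b = ⟨⟩-0ᵛ g (λ i → refl)
  ⟨⟩-combination {suc k} g a b = begin
    ⟨ g , combination a b ⟩
      ≈⟨ ⟨⟩-congˡ g (λ i → +-comm (a zero * b zero i) (combination (a ∘ suc) (b ∘ suc) i)) ⟩
    ⟨ g , combination (a ∘ suc) (b ∘ suc) +[ a zero ] b zero ⟩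
      ≈⟨ ⟨⟩-+[] g (combination (a ∘ suc) (b ∘ suc)) (a zero) (b zero) ⟩
    ⟨ g , combination (a ∘ suc) (b ∘ suc) ⟩ + a zero * ⟨ g , b zero ⟩
      ≈⟨ +-congʳ (⟨⟩-combination g (a ∘ suc) (b ∘ suc)) ⟩
    sum (λ j → a (suc j) * ⟨ g , b (suc j) ⟩) + a zero * ⟨ g , b zero ⟩
      ≈⟨ +-comm _ _ ⟩
    sum (λ j → a j * ⟨ g , b j ⟩) ∎

  ⟨⟩-annihilates-combination : ∀ {k} g (a : Vector Carrier k) b →
    (∀ j → ⟨ g , b j ⟩ ≈ 0#) → ⟨ g , combination a b ⟩ ≈ 0#
  ⟨⟩-annihilates-combination g a b gb≈0 = trans (⟨⟩-combination g a b)
    (sum-zero (λ j → trans (*-congˡ (gb≈0 j)) (zeroʳ (a j))))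

  unit : Fin (suc n) → Coordinates
  unit i j = 𝟙 (j Fin.≟ i)

  unit-diagonal : ∀ i → unit i i ≈ 1#
  unit-diagonal i = 𝟙-yes (i Fin.≟ i) ≡.refl

  unitPoint : Fin (suc n) → Point
  unitPoint i = unit i , λ unit≋0 → 1≉0 (trans (sym (unit-diagonal i)) (unit≋0 i))

  ⟨⟩-unit : ∀ g i → ⟨ g , unit i ⟩ ≈ g i
  ⟨⟩-unit g i = sum-𝟙-unique (Fin._≟ i) g i ≡.refl (λ _ j≡i → j≡i)

  punchIn-cover : ∀ {ℓ} {P : Fin (suc n) → Set ℓ} i → P i → (∀ r → P (punchIn i r)) → ∀ j → P j
  punchIn-cover {P = P} i Pi Pr j with i Fin.≟ j
  ... | yes ≡.refl = Pi
  ... | no  i≢j    = ≡.subst P (Fin.punchIn-punchOut i≢j) (Pr (punchOut i≢j))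

  -- As `g i` is invertible, the i-th coordinate can be recovered from the value of `g` and the
  -- other coordinates. The kernel of `g` can therefore be handled through n coordinates.
  ⟨⟩-determines : ∀ g {i v w} → g i ≉0 → ⟨ g , v ⟩ ≈ ⟨ g , w ⟩ →
                  (∀ r → v (punchIn i r) ≈ w (punchIn i r)) → v ≋ w
  ⟨⟩-determines g {i} {v} {w} gi≉0 gv≈gw agree = punchIn-cover i
    (*-cancelʳ gi≉0 (trans (*-comm _ _) (trans (+-cancelʳ _ _ _ (begin
      g i * v i + rest v  ≈⟨ sum-remove (λ j → g j * v j) ⟨
      ⟨ g , v ⟩           ≈⟨ gv≈gw ⟩
      ⟨ g , w ⟩           ≈⟨ sum-remove (λ j → g j * w j) ⟩
      g i * w i + rest w  ≈⟨ +-congˡ (sum-cong-≋ (λ r → *-congˡ (agree r))) ⟨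
      g i * w i + rest v  ∎)) (*-comm _ _))))
    agree
    where
    rest : Coordinates → Carrier
    rest u = sum (λ r → g (punchIn i r) * u (punchIn i r))

  coordinate≉0 : ((v , _) : Point) → ∃[ i ] v i ≉0
  coordinate≉0 (v , v≢0) = Fin.¬∀⟶∃¬ (suc n) _ (λ i → v i ≈? 0#) v≢0

  module _ {k} (U : Subspace k) where
    open Subspace U

    combination-injective : ∀ a a′ → combination a basis ≋ combination a′ basis → ∀ j → a j ≈ a′ j
    combination-injective a a′ eq j =
      x∙y⁻¹≈ε⇒x≈y _ _ (independent (λ j → a j - a′ j) (λ i → begin
        sum (λ j → (a j - a′ j) * basis j i)
          ≈⟨ sum-cong-≋ (λ j → [y-z]x≈yx-zx (basis j i) (a j) (a′ j)) ⟩
        sum (λ j → a j * basis j i - a′ j * basis j i)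
          ≈⟨ ∑-distrib-+ (λ j → a j * basis j i) _ ⟩
        combination a basis i + sum (λ j → - (a′ j * basis j i))
          ≈⟨ +-congˡ (sum-neg (λ j → a′ j * basis j i)) ⟩
        combination a basis i - combination a′ basis i
          ≈⟨ x≈y⇒x∙y⁻¹≈ε (eq i) ⟩
        0# ∎) j)

    combination-indicator : ∀ j → combination (λ l → 𝟙 (l Fin.≟ j)) basis ≋ basis j
    combination-indicator j i = trans (sum-cong-≋ (λ l → *-comm _ (basis l i)))
      (sum-𝟙-unique (Fin._≟ j) (λ l → basis l i) j ≡.refl (λ _ l≡j → l≡j))

    basis-≁ : ∀ {i j} → ¬ i ≡ j → ∀ s → ¬ s · basis i ≋ basis j
    basis-≁ {i} {j} i≢j s sbᵢ≋bⱼ = 1≉0 (begin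
      1#                ≈⟨ 𝟙-yes (j Fin.≟ j) ≡.refl ⟨
      𝟙 (j Fin.≟ j)     ≈⟨ combination-injective (λ l → s * 𝟙 (l Fin.≟ i)) (λ l → 𝟙 (l Fin.≟ j)) eq j ⟨
      s * 𝟙 (j Fin.≟ i) ≈⟨ *-congˡ (𝟙-no (j Fin.≟ i) (i≢j ∘ ≡.sym)) ⟩
      s * 0#            ≈⟨ zeroʳ s ⟩
      0#                ∎)
      where
      eq : combination (λ l → s * 𝟙 (l Fin.≟ i)) basis ≋ combination (λ l → 𝟙 (l Fin.≟ j)) basis
      eq k = begin
        combination (λ l → s * 𝟙 (l Fin.≟ i)) basis k  ≈⟨ combination-· s (λ l → 𝟙 (l Fin.≟ i)) basis k ⟩
        s * combination (λ l → 𝟙 (l Fin.≟ i)) basis k  ≈⟨ *-congˡ (combination-indicator i k) ⟩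
        s * basis i k                                  ≈⟨ sbᵢ≋bⱼ k ⟩
        basis j k                                      ≈⟨ combination-indicator j k ⟨
        combination (λ l → 𝟙 (l Fin.≟ j)) basis k      ∎

    -- In a linear relation, a nonzero coefficient of the new vector would allow solving for it, and
    -- P would lie on `U`.
    extend : ∀ P → ¬ P on U → Subspace (suc k)
    extend P@(v , _) ¬on = record { basis = v ∷ basis ; independent = λ a a≋0 →
      let a₀≈0 = decidable-stable (a zero ≈? 0#) (λ a₀≉0 → ¬on (solveFor a a≋0 a₀≉0))
      in λ { zero    → a₀≈0
           ; (suc j) → independent (a ∘ suc) (λ i → begin
               combination (a ∘ suc) basis i                 ≈⟨ +-identityˡ _ ⟨
               0# + combination (a ∘ suc) basis i            ≈⟨ +-congʳ (zeroˡ (v i)) ⟨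
               0# * v i + combination (a ∘ suc) basis i      ≈⟨ +-congʳ (*-congʳ a₀≈0) ⟨
               a zero * v i + combination (a ∘ suc) basis i  ≈⟨ a≋0 i ⟩
               0#                                            ∎) j } }
      where
      solveFor : ∀ a → combination a (v ∷ basis) ≋ 0ᵛ → a zero ≉0 → P on U
      solveFor a a≋0 a₀≉0 = let t , ta₀≈1 = inverse a₀≉0 in
        (λ j → - t * a (suc j)) , λ i → begin
          combination (λ j → - t * a (suc j)) basis i  ≈⟨ combination-· (- t) (a ∘ suc) basis i ⟩
          - t * combination (a ∘ suc) basis i          ≈⟨ *-congˡ (+-inverseʳ-unique _ _ (a≋0 i)) ⟩
          - t * - (a zero * v i)                       ≈⟨ -‿distribˡ-* t _ ⟨
          - (t * - (a zero * v i))                     ≈⟨ -‿cong (-‿distribʳ-* t _) ⟨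
          - - (t * (a zero * v i))                     ≈⟨ -‿involutive _ ⟩
          t * (a zero * v i)                           ≈⟨ *-assoc t (a zero) (v i) ⟨
          t * a zero * v i                             ≈⟨ *-congʳ ta₀≈1 ⟩
          1# * v i                                     ≈⟨ *-identityˡ (v i) ⟩
          v i                                          ∎

    dependent⇒on : ∀ P a → combination a (proj₁ P ∷ basis) ≋ 0ᵛ → (∃[ j ] a j ≉0) → P on U
    dependent⇒on P a a≋0 (j , aj≉0) = decidable-stable (P on? U) λ ¬on →
      aj≉0 (Subspace.independent (extend P ¬on) a a≋0 j)

    annihilator : k < suc n → Σ Coordinates λ g → (∃[ i ] g i ≉0) × (∀ j → ⟨ g , basis j ⟩ ≈ 0#)
    annihilator k<1+n = homogeneous-solution k<1+n (λ i j → basis j i)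

    -- A nonzero form that vanishes on `U` has a nonzero coefficient, which is its value at the
    -- corresponding unit vector.
    outside : k < suc n → ∃[ P ] ¬ P on U
    outside k<1+n =
      let g , (i , gi≉0) , gb≈0 = annihilator k<1+n
      in unitPoint i , λ (a , a≋unit) → gi≉0 (begin
        g i                          ≈⟨ ⟨⟩-unit g i ⟨
        ⟨ g , unit i ⟩               ≈⟨ ⟨⟩-congˡ g a≋unit ⟨
        ⟨ g , combination a basis ⟩  ≈⟨ ⟨⟩-annihilates-combination g a basis gb≈0 ⟩
        0#                           ∎)

  infix 4 _IsKernelOf_
  _IsKernelOf_ : ∀ {k} → Subspace k → Coordinates → Set _
  U IsKernelOf g = ∀ P → (P on U → ⟨ g , proj₁ P ⟩ ≈ 0#) × (⟨ g , proj₁ P ⟩ ≈ 0# → P on U)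

  annihilates-basis⇒annihilates-points : ∀ {k} g (U : Subspace k) →
    (∀ j → ⟨ g , Subspace.basis U j ⟩ ≈ 0#) → ∀ P → P on U → ⟨ g , proj₁ P ⟩ ≈ 0#
  annihilates-basis⇒annihilates-points g U gb≈0 P (a , a≋v) =
    trans (sym (⟨⟩-congˡ g a≋v)) (⟨⟩-annihilates-combination g a (Subspace.basis U) gb≈0)

  hyperplane⇒functional : (H : Hyperplane) → ∃[ g ] H IsKernelOf g
  hyperplane⇒functional H =
    let g , (i , gi≉0) , gb≈0 = annihilator H (ℕ.n<1+n n)
    in g , λ P → annihilates-basis⇒annihilates-points g H gb≈0 P , λ gv≈0 →
      -- These are n + 1 vectors in the kernel of `g`. Without coordinate i they have only n
      -- coordinates and so satisfy a nontrivial relation, which `⟨⟩-determines` extends to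
      -- coordinate i.
      let w = proj₁ P ∷ basis
          a , a≢0 , vanishes = homogeneous-solution (ℕ.n<1+n n) (λ j r → w j (punchIn i r))
          gw≈0 = λ { zero → gv≈0 ; (suc j) → gb≈0 j }
      in dependent⇒on H P a (⟨⟩-determines g gi≉0
           (trans (⟨⟩-annihilates-combination g a w gw≈0) (sym (⟨⟩-0ᵛ g (λ _ → refl)))) vanishes) a≢0
    where open Subspace H

  functional⇒hyperplane : ∀ g {i} → g i ≉0 → ∃[ H ] H IsKernelOf g
  functional⇒hyperplane g {i} gi≉0 = H , λ P →
    annihilates-basis⇒annihilates-points g H gb≈0 P ,
    λ gv≈0 → proj₁ P ∘ punchIn i , ⟨⟩-determines g gi≉0
      (trans (⟨⟩-annihilates-combination g (proj₁ P ∘ punchIn i) basis gb≈0) (sym gv≈0))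
      (coefficient (proj₁ P ∘ punchIn i))
    where
    t = proj₁ (inverse gi≉0)
    -- Unit vectors, corrected by multiples of `unit i` so that `g` kills them. Outside coordinate i
    -- they are the standard basis, so a vector of the kernel has its remaining coordinates as
    -- coefficients.
    basis : Vector Coordinates n
    basis j = unit (punchIn i j) +[ - (g (punchIn i j) * t) ] unit i
    gb≈0 : ∀ j → ⟨ g , basis j ⟩ ≈ 0#
    gb≈0 j = let gⱼ = g (punchIn i j) in begin
      ⟨ g , basis j ⟩
        ≈⟨ ⟨⟩-+[] g (unit (punchIn i j)) _ (unit i) ⟩
      ⟨ g , unit (punchIn i j) ⟩ + - (gⱼ * t) * ⟨ g , unit i ⟩
        ≈⟨ +-cong (⟨⟩-unit g (punchIn i j)) (*-congˡ (⟨⟩-unit g i)) ⟩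
      gⱼ + - (gⱼ * t) * g i
        ≈⟨ +-congˡ (-‿distribˡ-* (gⱼ * t) (g i)) ⟨
      gⱼ - gⱼ * t * g i
        ≈⟨ x≈y⇒x∙y⁻¹≈ε (sym (trans (*-assoc gⱼ t (g i))
             (trans (*-congˡ (proj₂ (inverse gi≉0))) (*-identityʳ gⱼ)))) ⟩
      0# ∎
    entry : ∀ j r → basis j (punchIn i r) ≈ unit (punchIn i j) (punchIn i r)
    entry j r = trans
      (+-congˡ (trans (*-congˡ (𝟙-no (punchIn i r Fin.≟ i) (Fin.punchInᵢ≢i i r))) (zeroʳ _)))
      (+-identityʳ _)
    coefficient : ∀ a r → combination a basis (punchIn i r) ≈ a r
    coefficient a r = begin
      sum (λ j → a j * basis j (punchIn i r))
        ≈⟨ sum-cong-≋ (λ j → *-congˡ (entry j r)) ⟩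
      sum (λ j → a j * 𝟙 (punchIn i r Fin.≟ punchIn i j))
        ≈⟨ sum-𝟙-unique (λ j → punchIn i r Fin.≟ punchIn i j) a r ≡.refl
             (λ j eq → ≡.sym (Fin.punchIn-injective i r j eq)) ⟩
      a r ∎
    H : Hyperplane
    H = record { basis = basis ; independent = λ a a≋0 r →
      trans (sym (coefficient a r)) (a≋0 (punchIn i r)) }

-- The list `points` as a faithful indexing of the projective points.

unique-lookup-injective : ∀ {a ℓ} (S : Setoid a ℓ) {xs : List (Setoid.Carrier S)} →
  Unique.Unique S xs → ∀ i j → Setoid._≈_ S (List.lookup xs i) (List.lookup xs j) → i ≡ j
unique-lookup-injective S (_ AllPairs.∷ _)   zero    zero    _  = ≡.refl
unique-lookup-injective S (x∉ AllPairs.∷ _)  zero    (suc j) eq =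
  contradiction eq (All.lookup x∉ (List∈.∈-lookup j))
unique-lookup-injective S (x∉ AllPairs.∷ _)  (suc i) zero    eq =
  contradiction (Setoid.sym S eq) (All.lookup x∉ (List∈.∈-lookup i))
unique-lookup-injective S (_ AllPairs.∷ xs!) (suc i) (suc j) eq =
  ≡.cong suc (unique-lookup-injective S xs! i j eq)

module Points {c ℓ₁ ℓ₂ q} (F : FiniteField c ℓ₁ ℓ₂ q) (n : ℕ) where

  open FiniteField F hiding (zero)
  open ProjectiveSpace F n
  open Membership pointSetoid using (_∈_)

  points-unique : Unique.Unique pointSetoid points
  points-unique = DecUnique.deduplicate-! pointDecSetoid _
    where
    pointDecSetoid : DecSetoid (c ⊔ ℓ₁) (c ⊔ ℓ₁)
    pointDecSetoid = record
      { isDecEquivalence = record { isEquivalence = Setoid.isEquivalence pointSetoid ; _≟_ = _∼?_ } }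

  asPoint-∼ : ∀ P {v} → v ≋ proj₁ P → Maybe.Any (P ∼_) (asPoint v)
  asPoint-∼ (w , w≢0) {v} v≋w with v ≋? 0ᵛ
  ... | yes v≋0 = contradiction (λ i → trans (sym (v≋w i)) (v≋0 i)) w≢0
  ... | no  _   = Maybe.just (1# , λ i → trans (*-identityˡ (w i)) (sym (v≋w i)))

  ∈-points : ∀ P → P ∈ points
  ∈-points P = let i , i≋P = nthVector-surjective (proj₁ P) in
    ∈Properties.∈-deduplicate⁺ pointSetoid _∼?_
      (λ {A} {B} {C} C∼B A∼B → ∼-trans {A} {B} {C} A∼B (∼-sym {C} {B} C∼B)) {z = P}
      (Any.mapMaybe⁺ (asPoint ∘ nthVector) {P = P ∼_} (allFin (q ^ suc n))
        (Any.map⁺ (Any.tabulate⁺ i (asPoint-∼ P i≋P))))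

  point : Fin (length points) → Point
  point = List.lookup points

  opaque
    pointIndex : Point → Fin (length points)
    pointIndex P = index (∈-points P)

    ∼-pointIndex : ∀ P → P ∼ point (pointIndex P)
    ∼-pointIndex P = Any.lookup-index (∈-points P)

    point-injective : ∀ i j → point i ∼ point j → i ≡ j
    point-injective = unique-lookup-injective pointSetoid points-unique

-- Projection from a point, and its adjoint on linear forms.

module Projection {c ℓ₁ ℓ₂ q} (F : FiniteField c ℓ₁ ℓ₂ q) (n : ℕ)
  (R : ProjectiveSpace.Point F n) where

  open FiniteField F hiding (zero)
  open FieldProperties F
  open ProjectiveSpace F n
  open LinearAlgebra F n
  open SetoidReasoning setoid

  private
    r : Coordinates
    r = proj₁ R
    i : Fin (suc n)
    i = proj₁ (coordinate≉0 R)
    t : Carrier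
    t = proj₁ (inverse (proj₂ (coordinate≉0 R)))
    t*rᵢ≈1 : t * r i ≈ 1#
    t*rᵢ≈1 = proj₂ (inverse (proj₂ (coordinate≉0 R)))

  -- The projection from R onto the hyperplane vᵢ = 0.
  π : Coordinates → Coordinates
  π v = v +[ - (v i * t) ] r

  π-cong : ∀ {v w} → v ≋ w → π v ≋ π w
  π-cong v≋w j = +-cong (v≋w j) (*-congʳ (-‿cong (*-congʳ (v≋w i))))

  π-+[] : ∀ v s w → π (v +[ s ] w) ≋ π v +[ s ] π w
  π-+[] v s w j = begin
    v j + s * w j + - ((v i + s * w i) * t) * r j
      ≈⟨ +-congˡ (*-congʳ (-1*x≈-x _)) ⟨
    v j + s * w j + - 1# * ((v i + s * w i) * t) * r j
      ≈⟨ rearrange (v j) (w j) (v i) (w i) s t (r j) (- 1#) ⟩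
    v j + - 1# * (v i * t) * r j + s * (w j + - 1# * (w i * t) * r j)
      ≈⟨ +-cong (+-congˡ (*-congʳ (-1*x≈-x _))) (*-congˡ (+-congˡ (*-congʳ (-1*x≈-x _)))) ⟩
    v j + - (v i * t) * r j + s * (w j + - (w i * t) * r j) ∎
    where
    -- Negation is represented by the factor `m`, instantiated with `- 1#`, which makes this a
    -- semiring identity.
    rearrange : ∀ vⱼ wⱼ vᵢ wᵢ s t rⱼ m → vⱼ + s * wⱼ + m * ((vᵢ + s * wᵢ) * t) * rⱼ
              ≈ vⱼ + m * (vᵢ * t) * rⱼ + s * (wⱼ + m * (wᵢ * t) * rⱼ)
    rearrange = solve 8 (λ vⱼ wⱼ vᵢ wᵢ s t rⱼ m →
      vⱼ :+ s :* wⱼ :+ m :* ((vᵢ :+ s :* wᵢ) :* t) :* rⱼ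
      := vⱼ :+ m :* (vᵢ :* t) :* rⱼ :+ s :* (wⱼ :+ m :* (wᵢ :* t) :* rⱼ)) refl
      where open Solver

  π-0 : ∀ {v} → v ≋ 0ᵛ → π v ≋ 0ᵛ
  π-0 {v} v≋0 j = begin
    v j + - (v i * t) * r j  ≈⟨ +-cong (v≋0 j) (*-congʳ (-‿cong (trans (*-congʳ (v≋0 i)) (zeroˡ t)))) ⟩
    0# + - 0# * r j          ≈⟨ +-identityˡ _ ⟩
    - 0# * r j               ≈⟨ *-congʳ -0#≈0# ⟩
    0# * r j                 ≈⟨ zeroˡ (r j) ⟩
    0#                       ∎

  π-· : ∀ s v → π (s · v) ≋ s · π v
  π-· s v j = begin
    π (s · v) j            ≈⟨ π-cong (λ k → +-identityˡ (s * v k)) j ⟨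
    π (0ᵛ +[ s ] v) j      ≈⟨ π-+[] 0ᵛ s v j ⟩
    π 0ᵛ j + s * π v j     ≈⟨ +-congʳ (π-0 (λ _ → refl) j) ⟩
    0# + s * π v j         ≈⟨ +-identityˡ _ ⟩
    s * π v j              ∎

  π-r≋0 : π r ≋ 0ᵛ
  π-r≋0 j = begin
    r j + - (r i * t) * r j  ≈⟨ +-congˡ (-‿distribˡ-* (r i * t) (r j)) ⟨
    r j - r i * t * r j      ≈⟨ x≈y⇒x∙y⁻¹≈ε (sym (trans
                                 (*-congʳ (trans (*-comm (r i) t) t*rᵢ≈1)) (*-identityˡ (r j)))) ⟩
    0#                       ∎

  π≋0⇒∼ : ∀ X → π (proj₁ X) ≋ 0ᵛ → R ∼ X
  π≋0⇒∼ (v , _) πv≋0 = v i * t , λ j → sym (x∙y⁻¹≈ε⇒x≈y _ _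
    (trans (+-congˡ (-‿distribˡ-* (v i * t) (r j))) (πv≋0 j)))

  -- The adjoint of `π`: it vanishes at R and agrees with `g` where the i-th coordinate is 0. It is
  -- the zero form when `g` is a multiple of `unit i`.
  pullback : Coordinates → Coordinates
  pullback g = g +[ - (t * ⟨ g , r ⟩) ] unit i

  ⟨⟩-π : ∀ g v → ⟨ g , π v ⟩ ≈ ⟨ pullback g , v ⟩
  ⟨⟩-π g v = begin
    ⟨ g , π v ⟩                                         ≈⟨ ⟨⟩-+[] g v _ r ⟩
    ⟨ g , v ⟩ + - (v i * t) * ⟨ g , r ⟩                 ≈⟨ +-cong (⟨⟩-comm g v) (move (v i) t ⟨ g , r ⟩) ⟩
    ⟨ v , g ⟩ + - (t * ⟨ g , r ⟩) * v i                 ≈⟨ +-congˡ (*-congˡ (⟨⟩-unit v i)) ⟨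
    ⟨ v , g ⟩ + - (t * ⟨ g , r ⟩) * ⟨ v , unit i ⟩      ≈⟨ ⟨⟩-+[] v g _ (unit i) ⟨
    ⟨ v , pullback g ⟩                                  ≈⟨ ⟨⟩-comm v (pullback g) ⟩
    ⟨ pullback g , v ⟩                                  ∎
    where
    move : ∀ x y z → - (x * y) * z ≈ - (y * z) * x
    move x y z = begin
      - (x * y) * z    ≈⟨ -‿distribˡ-* (x * y) z ⟨
      - (x * y * z)    ≈⟨ -‿cong (solve 3 (λ x y z → x :* y :* z := y :* z :* x) refl x y z) ⟩
      - (y * z * x)    ≈⟨ -‿distribˡ-* (y * z) x ⟩
      - (y * z) * x    ∎
      where open Solver

  private
    projectWith : (X : Point) → Dec (π (proj₁ X) ≋ 0ᵛ) → Point
    projectWith X (yes _)    = R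
    projectWith X (no πX≢0) = π (proj₁ X) , πX≢0

  -- The point R itself is projected to R, a junk value.
  project : Point → Point
  project X = projectWith X (π (proj₁ X) ≋? 0ᵛ)

  project-≋ : ∀ X → ¬ R ∼ X → proj₁ (project X) ≋ π (proj₁ X)
  project-≋ X ¬R∼X j with π (proj₁ X) ≋? 0ᵛ
  ... | yes πX≋0 = contradiction (π≋0⇒∼ X πX≋0) ¬R∼X
  ... | no  _    = refl

  π-∼⇒project-∼ : ∀ X Y → ¬ R ∼ X → ¬ R ∼ Y → ∀ s → s · π (proj₁ X) ≋ π (proj₁ Y) →
                  project X ∼ project Y
  π-∼⇒project-∼ X Y ¬R∼X ¬R∼Y s sπX≋πY = s , λ j →
    trans (*-congˡ {s} (project-≋ X ¬R∼X j)) (trans (sπX≋πY j) (sym (project-≋ Y ¬R∼Y j)))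

  project-cong : ∀ X Y → ¬ R ∼ X → X ∼ Y → project X ∼ project Y
  project-cong X Y ¬R∼X X∼Y@(s , sv≋w) = π-∼⇒project-∼ X Y ¬R∼X
    (λ R∼Y → ¬R∼X (∼-trans {R} {Y} {X} R∼Y (∼-sym {X} {Y} X∼Y)))
    s (λ j → trans (sym (π-· s (proj₁ X) j)) (π-cong sv≋w j))

  -- As `π` kills `r`, the relation becomes `π` X = - s `π` Y.
  collinear⇒project-∼ : ∀ X Y s → ¬ R ∼ X → ¬ R ∼ Y → r ≋ proj₁ X +[ s ] proj₁ Y →
                        project Y ∼ project X
  collinear⇒project-∼ X Y s ¬R∼X ¬R∼Y r≋ = π-∼⇒project-∼ Y X ¬R∼Y ¬R∼X (- s) λ j →
    trans (sym (-‿distribˡ-* s _)) (sym (+-inverseˡ-unique _ _ (begin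
      π (proj₁ X) j + s * π (proj₁ Y) j  ≈⟨ π-+[] (proj₁ X) s (proj₁ Y) j ⟨
      π (proj₁ X +[ s ] proj₁ Y) j       ≈⟨ π-cong r≋ j ⟨
      π r j                              ≈⟨ π-r≋0 j ⟩
      0#                                 ∎)))

  opaque
    -- Expand `π` in the equation `π` Y = u `π` X and solve for Y; the coefficient w collects the
    -- multiples of `r` that `π` has subtracted on the two sides.
    project-∼⇒collinear : ∀ X Y → ¬ R ∼ X → ¬ R ∼ Y → project X ∼ project Y →
                          ∃[ u ] ∃[ w ] proj₁ Y ≋ u · proj₁ X +[ w ] r
    project-∼⇒collinear X@(v , _) Y@(y , _) ¬R∼X ¬R∼Y (u , eq) =
      u , - (u * v i * t) + y i * t , λ j → begin
        y j
          ≈⟨ //-rightDividesʳ _ (y j) ⟨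
        y j + - (y i * t) * r j - - (y i * t) * r j
          ≈⟨ +-cong (πY≋ j) (trans (-‿distribˡ-* _ _) (*-congʳ (-‿involutive _))) ⟩
        u * (v j + - (v i * t) * r j) + y i * t * r j
          ≈⟨ +-congʳ (*-congˡ (+-congˡ (*-congʳ (-1*x≈-x _)))) ⟨
        u * (v j + - 1# * (v i * t) * r j) + y i * t * r j
          ≈⟨ rearrange u (v j) (v i) t (r j) (y i) (- 1#) ⟩
        u * v j + (- 1# * (u * v i * t) + y i * t) * r j
          ≈⟨ +-congˡ (*-congʳ (+-congʳ (-1*x≈-x _))) ⟩
        u * v j + (- (u * v i * t) + y i * t) * r j ∎
      where
      πY≋ : π y ≋ u · π v
      πY≋ j = trans (sym (project-≋ Y ¬R∼Y j)) (trans (sym (eq j)) (*-congˡ (project-≋ X ¬R∼X j)))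
      rearrange : ∀ u vⱼ vᵢ t rⱼ yᵢ m → u * (vⱼ + m * (vᵢ * t) * rⱼ) + yᵢ * t * rⱼ
                ≈ u * vⱼ + (m * (u * vᵢ * t) + yᵢ * t) * rⱼ
      rearrange = solve 7 (λ u vⱼ vᵢ t rⱼ yᵢ m →
        u :* (vⱼ :+ m :* (vᵢ :* t) :* rⱼ) :+ yᵢ :* t :* rⱼ
        := u :* vⱼ :+ (m :* (u :* vᵢ :* t) :+ yᵢ :* t) :* rⱼ) refl
        where open Solver

-- Words, their supports, and orthogonality to hyperplanes.

module DualWords
  {c ℓ₁ ℓ₂ q} (F : FiniteField c ℓ₁ ℓ₂ q) (n : ℕ)
  {c′ ℓ₁′ ℓ₂′ p} (K : FiniteField c′ ℓ₁′ ℓ₂′ p) where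

  private
    module 𝔽 where
      open FiniteField F hiding (zero) public
      open FieldProperties F public
  open FiniteField K hiding (zero)
  open FieldProperties K
  open ProjectiveSpace F n
  open LinearAlgebra F n
  open Points F n
  open HyperplaneCode F n K
  open SetoidReasoning setoid

  at-cong : ∀ (x : Word) P Q → P ∼ Q → x at P ≈ x at Q
  at-cong x P Q P∼Q = Func.cong x {P} {Q} P∼Q

  ∈supp-resp-∼ : ∀ (x : Word) P Q → P ∼ Q → P ∈supp x → Q ∈supp x
  ∈supp-resp-∼ x P Q P∼Q P∈x xQ≈0 = P∈x (trans (at-cong x P Q P∼Q) xQ≈0)

  ∈supp∧∉supp⇒≁ : ∀ (x : Word) P Q → P ∈supp x → x at Q ≈ 0# → ¬ Q ∼ P
  ∈supp∧∉supp⇒≁ x P Q P∈x xQ≈0 Q∼P = P∈x (trans (sym (at-cong x Q P Q∼P)) xQ≈0)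

  module _ (x : Word) where

    private
      supp? : ∀ P → Dec (P ∈supp x)
      supp? P = ¬? (x at P ≈? 0#)

    suppPoint : Fin (weight x) → Point
    suppPoint = List.lookup (List.filter supp? points)

    opaque
      suppPoint-∈ : ∀ i → suppPoint i ∈supp x
      suppPoint-∈ i = proj₂ (List∈.∈-filter⁻ supp? {xs = points}
        (List∈.∈-lookup {xs = List.filter supp? points} i))

      suppPoint-injective : ∀ i j → suppPoint i ∼ suppPoint j → i ≡ j
      suppPoint-injective = unique-lookup-injective pointSetoid (AllPairsₚ.filter⁺ supp? points-unique)

      suppPoint-surjective : ∀ P → P ∈supp x → ∃[ i ] P ∼ suppPoint i
      suppPoint-surjective P P∈x = index P∈filter , Any.lookup-index P∈filter
        where
        open Membership pointSetoid using (_∈_)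
        P∈filter : P ∈ List.filter supp? points
        P∈filter = ∈Properties.∈-filter⁺ pointSetoid supp?
          (λ {A} {B} → ∈supp-resp-∼ x A B) {v = P} (∈-points P) P∈x

    injection⇒≤weight : ∀ {m} (A : Fin m → Point) → (∀ i → A i ∈supp x) →
                        (∀ i j → A i ∼ A j → i ≡ j) → m ≤ weight x
    injection⇒≤weight A A∈x A-injective = Fin.injective⇒≤ {f = λ i → proj₁ (ix i)} λ {i} {j} eq →
      A-injective i j (∼-trans {A i} {suppPoint (proj₁ (ix i))} {A j} (proj₂ (ix i))
        (∼-sym {A j} {suppPoint (proj₁ (ix i))}
          (≡.subst (λ k → A j ∼ suppPoint k) (≡.sym eq) (proj₂ (ix j)))))
      where
      ix : ∀ i → ∃[ k ] A i ∼ suppPoint k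
      ix i = suppPoint-surjective (A i) (A∈x i)

    cover⇒weight≤ : ∀ {m} (B : Fin m → Point) →
                    (∀ P → P ∈supp x → ∃[ i ] B i ∼ P) → weight x ≤ m
    cover⇒weight≤ B cover = Fin.injective⇒≤ {f = λ i → proj₁ (ix i)} λ {i} {j} eq →
      suppPoint-injective i j (∼-trans {suppPoint i} {B (proj₁ (ix i))} {suppPoint j}
        (∼-sym {B (proj₁ (ix i))} {suppPoint i} (proj₂ (ix i)))
        (≡.subst (λ k → B k ∼ suppPoint j) (≡.sym eq) (proj₂ (ix j))))
      where
      ix : ∀ i → ∃[ k ] B k ∼ suppPoint i
      ix i = cover (suppPoint i) (suppPoint-∈ i)

    -- `B i` is dropped from the cover, as `B j` is the same projective point.
    redundantCover⇒weight< : ∀ {m} (B : Fin m → Point) →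
      (∀ P → P ∈supp x → ∃[ i ] B i ∼ P) → ∀ i j → ¬ i ≡ j → B i ∼ B j → weight x < m
    redundantCover⇒weight< {suc m} B cover i j i≢j Bi∼Bj =
      s≤s (cover⇒weight≤ (B ∘ punchIn i) λ P P∈x → skip P (cover P P∈x))
      where
      at-punchOut : ∀ P k (i≢k : ¬ i ≡ k) → B k ∼ P → ∃[ l ] B (punchIn i l) ∼ P
      at-punchOut P k i≢k Bk∼P = punchOut i≢k ,
        ≡.subst (λ l → B l ∼ P) (≡.sym (Fin.punchIn-punchOut i≢k)) Bk∼P
      skip : ∀ P → ∃[ k ] B k ∼ P → ∃[ l ] B (punchIn i l) ∼ P
      skip P (k , Bk∼P) with i Fin.≟ k
      ... | no  i≢k    = at-punchOut P k i≢k Bk∼P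
      ... | yes ≡.refl = at-punchOut P j i≢j
        (∼-trans {B j} {B i} {P} (∼-sym {B i} {B j} Bi∼Bj) Bk∼P)

  isZero? : ∀ g (P : Point) → Dec (⟨ g , proj₁ P ⟩ 𝔽.≈ 𝔽.0#)
  isZero? g P = ⟨ g , proj₁ P ⟩ 𝔽.≈? 𝔽.0#

  infix 4 _⊥_
  -- Orthogonality to the indicator of the zeros of `g`. For a nonzero form these make up a
  -- hyperplane; for the zero form they are all points, and the condition says that the entries of
  -- `x` sum to zero.
  _⊥_ : Word → Coordinates → Set ℓ₁′
  x ⊥ g = sum (λ i → x at point i * 𝟙 (isZero? g (point i))) ≈ 0#

  inc-kernel : ∀ H g → H IsKernelOf g → ∀ P → incidenceVector H at P ≈ 𝟙 (isZero? g P)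
  inc-kernel H g H-ker P = 𝟙-cong (P on? H) (isZero? g P) (proj₁ (H-ker P)) (proj₂ (H-ker P))

  sum-sum-swap : ∀ {k m} (x : Vector Carrier k) (a : Vector Carrier m) (e : Fin m → Fin k → Carrier) →
    sum (λ i → x i * sum (λ j → a j * e j i)) ≈ sum (λ j → a j * sum (λ i → x i * e j i))
  sum-sum-swap x a e = begin
    sum (λ i → x i * sum (λ j → a j * e j i))
      ≈⟨ sum-cong-≋ (λ i → *-distribˡ-sum (x i) (λ j → a j * e j i)) ⟩
    sum (λ i → sum (λ j → x i * (a j * e j i)))
      ≈⟨ sum-cong-≋ (λ i → sum-cong-≋ (λ j → x*yz≈y*xz (x i) (a j) (e j i))) ⟩
    sum (λ i → sum (λ j → a j * (x i * e j i)))
      ≈⟨ ∑-comm (λ i j → a j * (x i * e j i)) ⟩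
    sum (λ j → sum (λ i → a j * (x i * e j i)))
      ≈⟨ sum-cong-≋ (λ j → *-distribˡ-sum (a j) (λ i → x i * e j i)) ⟨
    sum (λ j → a j * sum (λ i → x i * e j i)) ∎

  ⊥⇒inDual : ∀ (x : Word) → (∀ g → x ⊥ g) → InDual x
  ⊥⇒inDual x x⊥ y (m , a , H , y≈) = begin
    sum (λ i → x at point i * y at point i)
      ≈⟨ sum-cong-≋ (λ i → *-congˡ {x at point i} (y≈ (point i))) ⟩
    sum (λ i → x at point i * sum (λ j → a j * incidenceVector (H j) at point i))
      ≈⟨ sum-sum-swap (λ i → x at point i) a (λ j i → incidenceVector (H j) at point i) ⟩
    sum (λ j → a j * sum (λ i → x at point i * incidenceVector (H j) at point i))
      ≈⟨ sum-zero (λ j → trans (*-congˡ (orthogonal (H j))) (zeroʳ (a j))) ⟩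
    0# ∎
    where
    orthogonal : ∀ H → sum (λ i → x at point i * incidenceVector H at point i) ≈ 0#
    orthogonal H = let g , H-ker = hyperplane⇒functional H in
      trans (sum-cong-≋ (λ i → *-congˡ {x at point i} (inc-kernel H g H-ker (point i)))) (x⊥ g)

  inDual⇒⊥-nonzero : ∀ (x : Word) → InDual x → ∀ g {i} → g i 𝔽.≉0 → x ⊥ g
  inDual⇒⊥-nonzero x x-dual g gi≉0 = let H , H-ker = functional⇒hyperplane g gi≉0 in
    trans (sum-cong-≋ (λ i → *-congˡ {x at point i} (sym (inc-kernel H g H-ker (point i)))))
      (x-dual (incidenceVector H) (1 , (λ _ → 1#) , (λ _ → H) , λ P →
        sym (trans (+-identityʳ _) (*-identityˡ _))))

  -- A formal sum of points, in which the coefficients of coinciding points add up. Both the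
  -- projected word and the difference of two lines are built in this way.
  pointCombination : ∀ {m} → Vector Carrier m → Vector Point m → Word
  pointCombination a Q = record
    { to = λ P → sum (λ i → a i * 𝟙 (Q i ∼? P))
    ; cong = λ {P} {P′} P∼P′ → sum-cong-≋ (λ i → *-congˡ {a i} (𝟙-cong (Q i ∼? P) (Q i ∼? P′)
        (λ Q∼P → ∼-trans {Q i} {P} {P′} Q∼P P∼P′)
        (λ Q∼P′ → ∼-trans {Q i} {P′} {P} Q∼P′ (∼-sym {P} {P′} P∼P′))))
    }

  -- Exchange of summation: pairing a formal sum of points with an indicator evaluates the indicator
  -- at each `Q i`.
  pointCombination-⊥ : ∀ {m} (a : Vector Carrier m) (Q : Vector Point m) g →
    sum (λ i → a i * 𝟙 (isZero? g (Q i))) ≈ 0# → pointCombination a Q ⊥ g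
  pointCombination-⊥ a Q g sum≈0 = begin
    sum (λ j → sum (λ i → a i * 𝟙 (Q i ∼? point j)) * φ (point j))
      ≈⟨ sum-cong-≋ (λ j → *-comm _ (φ (point j))) ⟩
    sum (λ j → φ (point j) * sum (λ i → a i * 𝟙 (Q i ∼? point j)))
      ≈⟨ sum-sum-swap (φ ∘ point) a (λ i j → 𝟙 (Q i ∼? point j)) ⟩
    sum (λ i → a i * sum (λ j → φ (point j) * 𝟙 (Q i ∼? point j)))
      ≈⟨ sum-cong-≋ (λ i → *-congˡ {a i} (evaluate (Q i))) ⟩
    sum (λ i → a i * φ (Q i))
      ≈⟨ sum≈0 ⟩
    0# ∎
    where
    φ : Point → Carrier
    φ P = 𝟙 (isZero? g P)
    zero-resp-∼ : ∀ P Q → P ∼ Q → ⟨ g , proj₁ P ⟩ 𝔽.≈ 𝔽.0# → ⟨ g , proj₁ Q ⟩ 𝔽.≈ 𝔽.0#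
    zero-resp-∼ P Q (s , sP≋Q) gP≈0 = 𝔽.trans (𝔽.sym (⟨⟩-congˡ g sP≋Q))
      (𝔽.trans (⟨⟩-· g s (proj₁ P)) (𝔽.trans (𝔽.*-congˡ gP≈0) (𝔽.zeroʳ s)))
    evaluate : ∀ P → sum (λ j → φ (point j) * 𝟙 (P ∼? point j)) ≈ φ P
    evaluate P = let P′ = point (pointIndex P) ; P∼P′ = ∼-pointIndex P in begin
      sum (λ j → φ (point j) * 𝟙 (P ∼? point j))
        ≈⟨ sum-𝟙-unique (λ j → P ∼? point j) (φ ∘ point) (pointIndex P) P∼P′
             (λ j P∼j → point-injective j (pointIndex P)
               (∼-trans {point j} {P} {P′} (∼-sym {P} {point j} P∼j) P∼P′)) ⟩
      φ P′
        ≈⟨ 𝟙-cong (isZero? g P′) (isZero? g P)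
             (zero-resp-∼ P′ P (∼-sym {P} {P′} P∼P′)) (zero-resp-∼ P P′ P∼P′) ⟩
      φ P ∎

  pointCombination-supp : ∀ {m} (a : Vector Carrier m) (Q : Vector Point m) P →
    P ∈supp pointCombination a Q → ∃[ i ] a i ≉0 × Q i ∼ P
  pointCombination-supp a Q P P∈ = decidable-stable
    (Fin.any? (λ i → ¬? (a i ≈? 0#) ×-dec Q i ∼? P))
    λ none → P∈ (sum-zero (λ i → vanishes none i))
    where
    vanishes : ¬ (∃[ i ] a i ≉0 × Q i ∼ P) → ∀ i → a i * 𝟙 (Q i ∼? P) ≈ 0#
    vanishes none i with a i ≈? 0#
    ... | yes ai≈0 = trans (*-congʳ ai≈0) (zeroˡ _)
    ... | no  ai≉0 = trans (*-congˡ (𝟙-no (Q i ∼? P) (λ Qi∼P → none (i , ai≉0 , Qi∼P)))) (zeroʳ _)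

  -- Uniqueness is asked only among nonzero coefficients, so that the junk image of the centre of a
  -- projection cannot interfere.
  pointCombination-single : ∀ {m} (a : Vector Carrier m) (Q : Vector Point m) P k →
    Q k ∼ P → (∀ j → a j ≉0 → Q j ∼ P → k ≡ j) → pointCombination a Q at P ≈ a k
  pointCombination-single a Q P k Qk∼P unique = begin
    sum (λ j → a j * 𝟙 (Q j ∼? P))  ≈⟨ sum-single k (λ j → a j * 𝟙 (Q j ∼? P)) vanishes ⟩
    a k * 𝟙 (Q k ∼? P)              ≈⟨ *-congˡ (𝟙-yes (Q k ∼? P) Qk∼P) ⟩
    a k * 1#                        ≈⟨ *-identityʳ (a k) ⟩
    a k                             ∎
    where
    vanishes : ∀ j → ¬ j ≡ k → a j * 𝟙 (Q j ∼? P) ≈ 0#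
    vanishes j j≢k with a j ≈? 0#
    ... | yes aj≈0 = trans (*-congʳ aj≈0) (zeroˡ _)
    ... | no  aj≉0 = trans (*-congˡ (𝟙-no (Q j ∼? P) (j≢k ∘ ≡.sym ∘ unique j aj≉0))) (zeroʳ _)

  module _ (char∣q : sum (replicate q 1#) ≈ 0#) where

    open Inverse 𝔽.enumeration using () renaming
      (to to indexOf; from to element; to-cong to index-cong;
       strictlyInverseˡ to index-element; strictlyInverseʳ to element-index)

    -- A linear form with values b and a at two points of a line vanishes at one
    -- or at all q + 1 points of that line.
    pencil : ∀ b a → sum (λ t → 𝟙 (b 𝔽.+ element t 𝔽.* a 𝔽.≈? 𝔽.0#)) + 𝟙 (a 𝔽.≈? 𝔽.0#) ≈ 1#
    pencil b a = pencil′ (a 𝔽.≈? 𝔽.0#) (b 𝔽.≈? 𝔽.0#)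
      where
      zero? : ∀ t → Dec (b 𝔽.+ element t 𝔽.* a 𝔽.≈ 𝔽.0#)
      zero? t = b 𝔽.+ element t 𝔽.* a 𝔽.≈? 𝔽.0#
      pencil′ : Dec (a 𝔽.≈ 𝔽.0#) → Dec (b 𝔽.≈ 𝔽.0#) →
                sum (𝟙 ∘ zero?) + 𝟙 (a 𝔽.≈? 𝔽.0#) ≈ 1#
      pencil′ (yes a≈0) b≈0? = begin
        sum (𝟙 ∘ zero?) + 𝟙 (a 𝔽.≈? 𝔽.0#)
          ≈⟨ +-cong (constant b≈0?) (𝟙-yes (a 𝔽.≈? 𝔽.0#) a≈0) ⟩
        0# + 1#  ≈⟨ +-identityˡ 1# ⟩
        1#       ∎
        where
        b≈b+ta : ∀ t → b 𝔽.≈ b 𝔽.+ element t 𝔽.* a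
        b≈b+ta t = 𝔽.sym (𝔽.trans (𝔽.+-congˡ (𝔽.trans (𝔽.*-congˡ a≈0) (𝔽.zeroʳ (element t)))) (𝔽.+-identityʳ b))
        -- The q points other than the one with value `a` are zeros all or none. They contribute q
        -- or 0, which agree in `K`.
        constant : Dec (b 𝔽.≈ 𝔽.0#) → sum (𝟙 ∘ zero?) ≈ 0#
        constant (yes b≈0) = trans (sum-cong-≋ (λ t → 𝟙-yes (zero? t) (𝔽.trans (𝔽.sym (b≈b+ta t)) b≈0))) char∣q
        constant (no  b≉0) = sum-zero (λ t → 𝟙-no (zero? t) (λ eq → b≉0 (𝔽.trans (b≈b+ta t) eq)))
      pencil′ (no a≉0) _ = let u , ua≈1 = 𝔽.inverse a≉0 in begin
        sum (𝟙 ∘ zero?) + 𝟙 (a 𝔽.≈? 𝔽.0#)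
          ≈⟨ +-cong (sum-cong-≋ (λ t → sym (*-identityˡ (𝟙 (zero? t))))) (𝟙-no (a 𝔽.≈? 𝔽.0#) a≉0) ⟩
        sum (λ t → 1# * 𝟙 (zero? t)) + 0#
          ≈⟨ +-identityʳ _ ⟩
        sum (λ t → 1# * 𝟙 (zero? t))
          ≈⟨ sum-𝟙-unique zero? (λ _ → 1#) (indexOf (𝔽.- b 𝔽.* u)) (root u ua≈1) (unique u ua≈1) ⟩
        1# ∎
        where
        solution : ∀ u → u 𝔽.* a 𝔽.≈ 𝔽.1# → 𝔽.- b 𝔽.* u 𝔽.* a 𝔽.≈ 𝔽.- b
        solution u ua≈1 = 𝔽.trans (𝔽.*-assoc (𝔽.- b) u a) (𝔽.trans (𝔽.*-congˡ ua≈1) (𝔽.*-identityʳ (𝔽.- b)))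
        root : ∀ u → u 𝔽.* a 𝔽.≈ 𝔽.1# →
               b 𝔽.+ element (indexOf (𝔽.- b 𝔽.* u)) 𝔽.* a 𝔽.≈ 𝔽.0#
        root u ua≈1 = 𝔽.trans (𝔽.+-congˡ (𝔽.trans (𝔽.*-congʳ (element-index _)) (solution u ua≈1)))
          (𝔽.-‿inverseʳ b)
        unique : ∀ u → u 𝔽.* a 𝔽.≈ 𝔽.1# → ∀ t → b 𝔽.+ element t 𝔽.* a 𝔽.≈ 𝔽.0# → t ≡ indexOf (𝔽.- b 𝔽.* u)
        unique u ua≈1 t eq = ≡.trans (≡.sym (index-element t)) (index-cong
          (𝔽.*-cancelʳ a≉0 (𝔽.trans (𝔽.+-inverseʳ-unique _ _ eq) (𝔽.sym (solution u ua≈1)))))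

    -- Every point lies, modulo p, on exactly one hyperplane of a pencil.
    total≈0 : 1 ≤ n → ∀ (x : Word) → InDual x → sum (λ i → x at point i) ≈ 0#
    total≈0 1≤n x x-dual = begin
      sum X
        ≈⟨ sum-cong-≋ (λ i → trans (sym (*-identityʳ (X i))) (*-congˡ {X i} (sym (pencil _ _)))) ⟩
      sum (λ i → X i * (sum (λ t → 𝟙 (⟨ e , v i ⟩ 𝔽.+ element t 𝔽.* ⟨ f , v i ⟩ 𝔽.≈? 𝔽.0#))
                        + 𝟙 (isZero? f (point i))))
        ≈⟨ sum-cong-≋ (λ i → trans (distribˡ (X i) _ _)
             (+-congʳ (trans (*-distribˡ-sum (X i) (λ t → 𝟙 (⟨ e , v i ⟩ 𝔽.+ element t 𝔽.* ⟨ f , v i ⟩ 𝔽.≈? 𝔽.0#)))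
               (sum-cong-≋ (λ t → *-congˡ {X i} (member i t)))))) ⟩
      sum (λ i → sum (λ t → X i * 𝟙 (isZero? (g t) (point i))) + X i * 𝟙 (isZero? f (point i)))
        ≈⟨ ∑-distrib-+ (λ i → sum (λ t → X i * 𝟙 (isZero? (g t) (point i))))
             (λ i → X i * 𝟙 (isZero? f (point i))) ⟩
      sum (λ i → sum (λ t → X i * 𝟙 (isZero? (g t) (point i))))
        + sum (λ i → X i * 𝟙 (isZero? f (point i)))
        ≈⟨ +-cong (trans (∑-comm (λ i t → X i * 𝟙 (isZero? (g t) (point i))))
                    (sum-zero (λ t → inDual⇒⊥-nonzero x x-dual (g t) {k} (g≉0 t))))
                  (inDual⇒⊥-nonzero x x-dual f {zero} f≉0) ⟩
      0# + 0#
        ≈⟨ +-identityˡ 0# ⟩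
      0# ∎
      where
      X : Vector Carrier (length points)
      X i = x at point i
      v : Fin (length points) → Coordinates
      v i = proj₁ (point i)
      -- The last index differs from the first since `1 ≤ n`, so `e` and `f` are independent; the
      -- forms `g t` together with `f` define the pencil.
      k : Fin (suc n)
      k = fromℕ n
      k≢0 : ¬ k ≡ zero
      k≢0 k≡0 = ℕ.<⇒≢ 1≤n (≡.sym (≡.trans (≡.sym (Fin.toℕ-fromℕ n)) (≡.cong toℕ k≡0)))
      e f : Coordinates
      e = unit k
      f = unit zero
      g : Fin q → Coordinates
      g t = e +[ element t ] f
      f≉0 : f zero 𝔽.≉0
      f≉0 eq = 𝔽.1≉0 (𝔽.trans (𝔽.sym (unit-diagonal zero)) eq)
      g≉0 : ∀ t → g t k 𝔽.≉0
      g≉0 t eq = 𝔽.1≉0 (𝔽.trans (𝔽.sym (𝔽.trans (𝔽.+-cong (unit-diagonal k)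
        (𝔽.trans (𝔽.*-congˡ (𝔽.𝟙-no (k Fin.≟ zero) k≢0)) (𝔽.zeroʳ _))) (𝔽.+-identityʳ 𝔽.1#))) eq)
      g-value : ∀ i t → ⟨ g t , v i ⟩ 𝔽.≈ ⟨ e , v i ⟩ 𝔽.+ element t 𝔽.* ⟨ f , v i ⟩
      g-value i t = 𝔽.trans (⟨⟩-comm (g t) (v i)) (𝔽.trans (⟨⟩-+[] (v i) e (element t) f)
        (𝔽.+-cong (⟨⟩-comm (v i) e) (𝔽.*-congˡ (⟨⟩-comm (v i) f))))
      member : ∀ i t → 𝟙 (⟨ e , v i ⟩ 𝔽.+ element t 𝔽.* ⟨ f , v i ⟩ 𝔽.≈? 𝔽.0#)
                     ≈ 𝟙 (isZero? (g t) (point i))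
      member i t = 𝟙-cong (⟨ e , v i ⟩ 𝔽.+ element t 𝔽.* ⟨ f , v i ⟩ 𝔽.≈? 𝔽.0#) (isZero? (g t) (point i))
        (𝔽.trans (g-value i t)) (𝔽.trans (𝔽.sym (g-value i t)))

    inDual⇒⊥ : 1 ≤ n → ∀ (x : Word) → InDual x → ∀ g → x ⊥ g
    inDual⇒⊥ 1≤n x x-dual g with g ≋? 0ᵛ
    ... | no  g≢0 = inDual⇒⊥-nonzero x x-dual g (proj₂ (coordinate≉0 (g , g≢0)))
    ... | yes g≋0 = trans
      (sum-cong-≋ (λ i → trans
        (*-congˡ {x at point i} (𝟙-yes (isZero? g (point i))
          (𝔽.trans (⟨⟩-comm g (proj₁ (point i))) (⟨⟩-0ᵛ (proj₁ (point i)) g≋0))))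
        (*-identityʳ _)))
      (total≈0 1≤n x x-dual)

-- Coordinates in two planes through a common line.

splitAt-injective : ∀ m {n} (i j : Fin (m ℕ.+ n)) → splitAt m i ≡ splitAt m j → i ≡ j
splitAt-injective m {n} i j eq = ≡.trans (≡.sym (Fin.join-splitAt m n i))
  (≡.trans (≡.cong (join m n) eq) (Fin.join-splitAt m n j))

-- For independent b₀, b₁, b₂, b₃, the points u b₀ + w (b₂ + t b₁) and
-- u b₀ + w (b₃ + t b₁) of two planes through the line b₀ b₁.
module TwoPlanes {c ℓ₁ ℓ₂ q} (F : FiniteField c ℓ₁ ℓ₂ q) (n : ℕ)
  (U : ProjectiveSpace.Subspace F n 4) where

  open FiniteField F hiding (zero)
  open FieldProperties F
  open ProjectiveSpace F n
  open LinearAlgebra F n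
  open Subspace U
  open Inverse enumeration using () renaming
    (from to element; to-cong to index-cong; strictlyInverseˡ to index-element)

  Index : Set
  Index = Fin q ⊎ Fin q

  apex : Index → Coordinates
  apex = [ const (basis 2F) , const (basis 3F) ]′

  parameter : Index → Carrier
  parameter = [ element , element ]′

  coefficients : Carrier → Carrier → Index → Vector Carrier 4
  coefficients u w (inj₁ t) = u ∷ w * element t ∷ w ∷ 0# ∷ []
  coefficients u w (inj₂ t) = u ∷ w * element t ∷ 0# ∷ w ∷ []

  vector : Carrier → Carrier → Index → Coordinates
  vector u w τ = u · basis 0F +[ w ] (apex τ +[ parameter τ ] basis 1F)

  combination-coefficients : ∀ u w τ → combination (coefficients u w τ) basis ≋ vector u w τ
  combination-coefficients u w (inj₁ t) i =
    solve 7 (λ u w t x y z v → u :* x :+ (w :* t :* y :+ (w :* z :+ (con 0 :* v :+ con 0)))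
                            := u :* x :+ w :* (z :+ t :* y))
      refl u w (element t) (basis 0F i) (basis 1F i) (basis 2F i) (basis 3F i)
    where open Solver
  combination-coefficients u w (inj₂ t) i =
    solve 7 (λ u w t x y z v → u :* x :+ (w :* t :* y :+ (con 0 :* z :+ (w :* v :+ con 0)))
                            := u :* x :+ w :* (v :+ t :* y))
      refl u w (element t) (basis 0F i) (basis 1F i) (basis 2F i) (basis 3F i)
    where open Solver

  element-injective : ∀ {i j} → element i ≈ element j → i ≡ j
  element-injective {i} {j} eq =
    ≡.trans (≡.sym (index-element i)) (≡.trans (index-cong eq) (index-element j))

  -- The parameter is the quotient of two coefficients, which a scalar does not change.
  proportional-coefficients : ∀ {s w w′ t t′} → w′ ≉0 → s * w ≈ w′ →
    s * (w * element t) ≈ w′ * element t′ → t ≡ t′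
  proportional-coefficients {s} {w} {w′} {t} {t′} w′≉0 sw≈w′ eq =
    element-injective (*-cancelʳ w′≉0 (trans (*-comm _ w′) (trans (*-congʳ (sym sw≈w′))
      (trans (*-assoc s w _) (trans eq (*-comm w′ _))))))

  scalar-coefficients : ∀ s a a′ → s · combination a basis ≋ combination a′ basis → ∀ j → s * a j ≈ a′ j
  scalar-coefficients s a a′ eq = combination-injective U (λ j → s * a j) a′
    (λ i → trans (combination-· s a basis i) (eq i))

  -- For fixed τ these points lie on the line joining b₀ to the apex point of τ, and w nonzero
  -- excludes b₀, the only common point of two such lines. In coefficients, the zero in the third or
  -- fourth place tells the planes apart.
  vector-injective : ∀ {u w u′ w′} τ τ′ → w ≉0 → w′ ≉0 →
    ∀ s → s · vector u w τ ≋ vector u′ w′ τ′ → τ ≡ τ′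
  vector-injective {u} {w} {u′} {w′} τ τ′ w≉0 w′≉0 s eq =
    compare τ τ′ (scalar-coefficients s (coefficients u w τ) (coefficients u′ w′ τ′) λ i →
      trans (*-congˡ {s} (combination-coefficients u w τ i))
        (trans (eq i) (sym (combination-coefficients u′ w′ τ′ i))))
    where
    compare : ∀ τ τ′ → (∀ j → s * coefficients u w τ j ≈ coefficients u′ w′ τ′ j) → τ ≡ τ′
    compare (inj₁ t) (inj₁ t′) eqs = ≡.cong inj₁ (proportional-coefficients w′≉0 (eqs 2F) (eqs 1F))
    compare (inj₂ t) (inj₂ t′) eqs = ≡.cong inj₂ (proportional-coefficients w′≉0 (eqs 3F) (eqs 1F))
    compare (inj₁ t) (inj₂ t′) eqs = contradiction (trans (sym (eqs 3F)) (zeroʳ s)) w′≉0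
    compare (inj₂ t) (inj₁ t′) eqs = contradiction (trans (sym (eqs 2F)) (zeroʳ s)) w′≉0

  vector≁basis₀ : ∀ {u w} τ → w ≉0 → ∀ s → ¬ s · basis 0F ≋ vector u w τ
  vector≁basis₀ {u} {w} τ w≉0 s eq = compare τ
    (scalar-coefficients s (1# ∷ 0# ∷ 0# ∷ 0# ∷ []) (coefficients u w τ) λ i →
      trans (*-congˡ {s} (basis₀ (basis 0F i) (basis 1F i) (basis 2F i) (basis 3F i)))
        (trans (eq i) (sym (combination-coefficients u w τ i))))
    where
    basis₀ : ∀ x y z v → 1# * x + (0# * y + (0# * z + (0# * v + 0#))) ≈ x
    basis₀ = solve 4 (λ x y z v → con 1 :* x :+ (con 0 :* y :+ (con 0 :* z :+ (con 0 :* v :+ con 0))) := x) refl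
      where open Solver
    compare : ∀ τ → (∀ j → s * (1# ∷ 0# ∷ 0# ∷ 0# ∷ []) j ≈ coefficients u w τ j) → _
    compare (inj₁ t) eqs = w≉0 (trans (sym (eqs 2F)) (zeroʳ s))
    compare (inj₂ t) eqs = w≉0 (trans (sym (eqs 3F)) (zeroʳ s))

  vector≢0 : ∀ {u w} τ → w ≉0 → ¬ vector u w τ ≋ 0ᵛ
  vector≢0 {u} {w} τ w≉0 eq = vector≁basis₀ {u} {w} τ w≉0 0# (λ i → trans (zeroˡ _) (sym (eq i)))

  -- With u = 0 and w = 1 one gets the points other than b₁ of the lines b₁ b₂ and b₁ b₃.
  apexPoint : Index → Point
  apexPoint τ = vector 0# 1# τ , vector≢0 {0#} {1#} τ 1≉0

-- The support of a minimum weight dual codeword.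

module MinimumWeight
  {c ℓ₁ ℓ₂ q} (F : FiniteField c ℓ₁ ℓ₂ q) (n : ℕ)
  {c′ ℓ₁′ ℓ₂′ p} (K : FiniteField c′ ℓ₁′ ℓ₂′ p)
  (3≤n : 3 ≤ n)
  (char∣q : FiniteField._≈_ K (FiniteField.sum K (replicate q (FiniteField.1# K))) (FiniteField.0# K))
  where

  private
    module 𝔽 where
      open FiniteField F hiding (zero) public
      open FieldProperties F public
  open FiniteField K hiding (zero)
  open FieldProperties K
  open ProjectiveSpace F n
  open LinearAlgebra F n
  open Points F n
  open HyperplaneCode F n K
  open DualWords F n K
  open SetoidReasoning setoid
  open Inverse 𝔽.enumeration using ()
    renaming (to to indexOf; from to element)

  module _ (x : Word) (x-min : IsMinimumWeightDualCodeword x) where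
    open IsMinimumWeightDualCodeword x-min

    private
      x⊥ : ∀ g → x ⊥ g
      x⊥ = inDual⇒⊥ char∣q (ℕ.≤-trans (s≤s z≤n) 3≤n) x inDual

    lighter⇒zero : ∀ y → InDual y → weight y < weight x → ∀ P → y at P ≈ 0#
    lighter⇒zero y y-dual lighter P = decidable-stable (y at P ≈? 0#) λ yP≉0 →
      ℕ.<⇒≱ lighter (minimal y y-dual (λ y≈0 → yP≉0 (y≈0 P)))

    module _ (R : Point) (xR≈0 : x at R ≈ 0#) where
      open Projection F n R

      R≁ : ∀ P → P ∈supp x → ¬ R ∼ P
      R≁ P P∈x = ∈supp∧∉supp⇒≁ x P R P∈x xR≈0

      -- The pushforward of `x` under the projection. The junk image of R carries the coefficient 0.
      projected : Word
      projected = pointCombination (λ j → x at point j) (λ j → project (point j))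

      -- Pairing with the zeros of `g` amounts to pairing `x` with the zeros of `pullback g`. Since
      -- that form may be zero, `x⊥` is stated for all forms.
      projected-dual : InDual projected
      projected-dual = ⊥⇒inDual projected λ g →
        pointCombination-⊥ (λ j → x at point j) (λ j → project (point j)) g
          (trans (sum-cong-≋ (summand g)) (x⊥ (pullback g)))
        where
        summand : ∀ g j → x at point j * 𝟙 (isZero? g (project (point j)))
                        ≈ x at point j * 𝟙 (isZero? (pullback g) (point j))
        summand g j = cases (R ∼? point j)
          where
          zero-left : R ∼ point j → ∀ z → x at point j * z ≈ 0#
          zero-left R∼j z = trans (*-congʳ (trans (sym (at-cong x R (point j) R∼j)) xR≈0)) (zeroˡ z)
          value : ¬ R ∼ point j → ⟨ g , proj₁ (project (point j)) ⟩ 𝔽.≈ ⟨ pullback g , proj₁ (point j) ⟩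
          value R≁j = 𝔽.trans (⟨⟩-congˡ g (project-≋ (point j) R≁j)) (⟨⟩-π g (proj₁ (point j)))
          cases : Dec (R ∼ point j) → x at point j * 𝟙 (isZero? g (project (point j)))
                                    ≈ x at point j * 𝟙 (isZero? (pullback g) (point j))
          cases (yes R∼j) = trans (zero-left R∼j _) (sym (zero-left R∼j _))
          cases (no  R≁j) = *-congˡ {x at point j}
            (𝟙-cong (isZero? g (project (point j))) (isZero? (pullback g) (point j))
              (𝔽.trans (𝔽.sym (value R≁j))) (𝔽.trans (value R≁j)))

      projected-cover : ∀ P → P ∈supp projected → ∃[ i ] project (suppPoint x i) ∼ P
      projected-cover P P∈ =
        let j , xj≉0 , j∼P = pointCombination-supp (λ j → x at point j) (λ j → project (point j)) P P∈
            i , j∼i = suppPoint-surjective x (point j) xj≉0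
            j∼ᵖi = project-cong (point j) (suppPoint x i) (R≁ (point j) xj≉0) j∼i
        in i , ∼-trans {project (suppPoint x i)} {project (point j)} {P}
                 (∼-sym {project (point j)} {project (suppPoint x i)} j∼ᵖi) j∼P

      -- The images of the support points of `x` cover the support of the projected word with at
      -- least one repetition, so it is lighter than `x`.
      collision⇒projected≈0 : ∀ X Y → X ∈supp x → Y ∈supp x → ¬ X ∼ Y → project X ∼ project Y →
                              ∀ P → projected at P ≈ 0#
      collision⇒projected≈0 X Y X∈x Y∈x X≁Y X∼ᵖY =
        let i , X∼i = suppPoint-surjective x X X∈x
            j , Y∼j = suppPoint-surjective x Y Y∈x
            Xᵢ = suppPoint x i
            Yⱼ = suppPoint x j
        in lighter⇒zero projected projected-dual
             (redundantCover⇒weight< projected (project ∘ suppPoint x) projected-cover i j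
               (λ i≡j → X≁Y (∼-trans {X} {Xᵢ} {Y} X∼i (∼-sym {Y} {Xᵢ}
                 (≡.subst (λ k → Y ∼ suppPoint x k) (≡.sym i≡j) Y∼j))))
               (∼-trans {project Xᵢ} {project X} {project Yⱼ}
                 (∼-sym {project X} {project Xᵢ} (project-cong X Xᵢ (R≁ X X∈x) X∼i))
                 (∼-trans {project X} {project Y} {project Yⱼ} X∼ᵖY
                   (project-cong Y Yⱼ (R≁ Y Y∈x) Y∼j))))

      -- Were X the only support point over its image, the projected word would have there the
      -- nonzero entry of `x` at X.
      projected≈0⇒collision : (∀ P → projected at P ≈ 0#) → ∀ X → X ∈supp x →
                              ∃[ Y ] Y ∈supp x × ¬ X ∼ Y × project X ∼ project Y
      projected≈0⇒collision projected≈0 X X∈x =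
        let j , xj≉0 , k≢j , j∼ᵖk = decidable-stable other? λ none →
              Xₖ∈x (trans (sym (only-k none)) (projected≈0 (project Xₖ)))
        in point j , xj≉0 ,
           (λ X∼j → k≢j (point-injective k j (∼-trans {Xₖ} {X} {point j} (∼-sym {X} {Xₖ} X∼k) X∼j))) ,
           ∼-trans {project X} {project Xₖ} {project (point j)} (project-cong X Xₖ (R≁ X X∈x) X∼k)
             (∼-sym {project (point j)} {project Xₖ} j∼ᵖk)
        where
        k = pointIndex X
        Xₖ = point k
        X∼k : X ∼ Xₖ
        X∼k = ∼-pointIndex X
        Xₖ∈x : Xₖ ∈supp x
        Xₖ∈x = ∈supp-resp-∼ x X Xₖ X∼k X∈x
        Other : Fin (length points) → Set _
        Other j = point j ∈supp x × ¬ k ≡ j × project (point j) ∼ project Xₖ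
        other? : Dec (∃ Other)
        other? = Fin.any? λ j →
          ¬? (x at point j ≈? 0#) ×-dec ¬? (k Fin.≟ j) ×-dec project (point j) ∼? project Xₖ
        only-k : ¬ ∃ Other → projected at project Xₖ ≈ x at Xₖ
        only-k none = pointCombination-single (λ j → x at point j) (λ j → project (point j)) (project Xₖ) k
          (∼-refl {project Xₖ})
          (λ j xj≉0 j∼ᵖk → decidable-stable (k Fin.≟ j) (λ k≢j → none (j , xj≉0 , k≢j , j∼ᵖk)))

    -- The families `line` used here join a base point, obtained for w = 0, to another point; w
    -- nonzero excludes the base point.
    SupportPointIn : (𝔽.Carrier → 𝔽.Carrier → Coordinates) → Set _
    SupportPointIn line =
      ∃[ P ] P ∈supp x × ∃[ u ] ∃[ w ] w 𝔽.≉0 × proj₁ P ≋ line u w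

    -- A point R off the support on a secant is projected to the zero word, so
    -- that no line through R is a tangent.
    second-point : ∀ R X Y s → x at R ≈ 0# → X ∈supp x → Y ∈supp x → ¬ Y ∼ X →
      proj₁ R ≋ proj₁ X +[ s ] proj₁ Y → ∀ Z → Z ∈supp x →
      SupportPointIn (λ u w → u · proj₁ Z +[ w ] proj₁ R)
    second-point R X Y s xR≈0 X∈x Y∈x Y≁X R≋ Z Z∈x = conclude
      (projected≈0⇒collision R xR≈0 (collision⇒projected≈0 R xR≈0 Y X Y∈x X∈x Y≁X Y∼ᵖX) Z Z∈x)
      where
      open Projection F n R
      Y∼ᵖX : project Y ∼ project X
      Y∼ᵖX = collinear⇒project-∼ X Y s (R≁ R xR≈0 X X∈x) (R≁ R xR≈0 Y Y∈x) R≋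
      onLineThrough : ∀ P → P ∈supp x → ¬ Z ∼ P →
        (∃[ u ] ∃[ w ] proj₁ P ≋ u · proj₁ Z +[ w ] proj₁ R) →
        SupportPointIn (λ u w → u · proj₁ Z +[ w ] proj₁ R)
      onLineThrough P P∈x Z≁P (u , w , P≋) = P , P∈x , u , w ,
        (λ w≈0 → Z≁P (u , λ i → 𝔽.sym (𝔽.trans (P≋ i)
          (+[]-zeroˡ {u · proj₁ Z} {w} {proj₁ R} w≈0 i)))) , P≋
      conclude : (∃[ P ] P ∈supp x × ¬ Z ∼ P × project Z ∼ project P) →
        SupportPointIn (λ u w → u · proj₁ Z +[ w ] proj₁ R)
      conclude (P , P∈x , Z≁P , Z∼ᵖP) = onLineThrough P P∈x Z≁P
        (project-∼⇒collinear Z P (R≁ R xR≈0 Z Z∈x) (R≁ R xR≈0 P P∈x) Z∼ᵖP)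

    support-point-on-line : ∀ X Y Z → X ∈supp x → Y ∈supp x → Z ∈supp x → ¬ Y ∼ X → ∀ s →
      SupportPointIn (λ u w → u · proj₁ Z +[ w ] (proj₁ X +[ s ] proj₁ Y))
    support-point-on-line X Y Z X∈x Y∈x Z∈x Y≁X s = cases (x at R ≈? 0#)
      where
      R : Point
      R = proj₁ X +[ s ] proj₁ Y , λ R≋0 → Y≁X (𝔽.- s , λ i → 𝔽.trans (𝔽.sym (𝔽.-‿distribˡ-* s _))
        (𝔽.sym (𝔽.+-inverseˡ-unique _ _ (R≋0 i))))
      cases : Dec (x at R ≈ 0#) →
        SupportPointIn (λ u w → u · proj₁ Z +[ w ] proj₁ R)
      cases (yes xR≈0) = second-point R X Y s xR≈0 X∈x Y∈x Y≁X (λ _ → 𝔽.refl) Z Z∈x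
      cases (no  R∈x)  = R , R∈x , 𝔽.0# , 𝔽.1# , 𝔽.1≉0 , λ i →
        𝔽.sym (0·+[1]-identity {proj₁ Z} {proj₁ R} i)

    module _ (U : Subspace 4) where
      open TwoPlanes F n U
      open Subspace U

      sign : Index → Carrier
      sign = [ const 1# , const (- 1#) ]′

      -- The difference of the lines b₁ b₂ and b₁ b₃; their common point b₁ cancels.
      lineDifference : Word
      lineDifference = pointCombination (sign ∘ splitAt q) (apexPoint ∘ splitAt q)

      -- By `pencil` any form has 1 zero modulo p on each of the two lines; the term for b₁ occurs
      -- in both counts and cancels.
      lineDifference-dual : InDual lineDifference
      lineDifference-dual = ⊥⇒inDual lineDifference λ g →
        pointCombination-⊥ (sign ∘ splitAt q) (apexPoint ∘ splitAt q) g (begin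
          sum (λ i → sign (splitAt q i) * 𝟙 (isZero? g (apexPoint (splitAt q i))))
            ≈⟨ sum-splitAt q (λ τ → sign τ * 𝟙 (isZero? g (apexPoint τ))) ⟩
          sum (λ t → 1# * 𝟙 (isZero? g (apexPoint (inj₁ t)))) + sum (λ t → - 1# * 𝟙 (isZero? g (apexPoint (inj₂ t))))
            ≈⟨ +-cong (sum-cong-≋ (λ t → trans (*-identityˡ _) (member g (inj₁ t))))
                 (trans (sum-cong-≋ (λ t → trans (-1*x≈-x _) (-‿cong (member g (inj₂ t)))))
                        (sum-neg (λ t → line g (inj₂ t)))) ⟩
          sum (λ t → line g (inj₁ t)) - sum (λ t → line g (inj₂ t))
            ≈⟨ x≈y⇒x∙y⁻¹≈ε (+-cancelʳ _ _ _ (trans (pencil char∣q ⟨ g , basis 2F ⟩ ⟨ g , basis 1F ⟩)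
                 (sym (pencil char∣q ⟨ g , basis 3F ⟩ ⟨ g , basis 1F ⟩)))) ⟩
          0# ∎)
        where
        line? : ∀ g τ → Dec (⟨ g , apex τ ⟩ 𝔽.+ parameter τ 𝔽.* ⟨ g , basis 1F ⟩ 𝔽.≈ 𝔽.0#)
        line? g τ = ⟨ g , apex τ ⟩ 𝔽.+ parameter τ 𝔽.* ⟨ g , basis 1F ⟩ 𝔽.≈? 𝔽.0#
        line : Coordinates → Index → Carrier
        line g τ = 𝟙 (line? g τ)
        value : ∀ g τ → ⟨ g , vector 𝔽.0# 𝔽.1# τ ⟩ 𝔽.≈ ⟨ g , apex τ ⟩ 𝔽.+ parameter τ 𝔽.* ⟨ g , basis 1F ⟩
        value g τ = 𝔽.trans
          (⟨⟩-congˡ g (0·+[1]-identity {basis 0F} {apex τ +[ parameter τ ] basis 1F}))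
          (⟨⟩-+[] g (apex τ) (parameter τ) (basis 1F))
        member : ∀ g τ → 𝟙 (isZero? g (apexPoint τ)) ≈ line g τ
        member g τ = 𝟙-cong (isZero? g (apexPoint τ)) (line? g τ)
          (𝔽.trans (𝔽.sym (value g τ))) (𝔽.trans (value g τ))

      lineDifference-nonZero : NonZeroWord lineDifference
      lineDifference-nonZero zero-word = 1≉0 (begin
        1#                              ≡⟨ ≡.cong sign (Fin.splitAt-↑ˡ q (indexOf 𝔽.0#) q) ⟨
        sign (splitAt q i)              ≈⟨ pointCombination-single (sign ∘ splitAt q) (apexPoint ∘ splitAt q)
                                             (apexPoint (splitAt q i)) i (∼-refl {apexPoint (splitAt q i)})
                                             (λ j _ (s , eq) → splitAt-injective q i j (≡.sym
                                               (vector-injective (splitAt q j) (splitAt q i) 𝔽.1≉0 𝔽.1≉0 s eq))) ⟨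
        lineDifference at apexPoint (splitAt q i) ≈⟨ zero-word (apexPoint (splitAt q i)) ⟩
        0#                              ∎)
        where
        -- The index of b₂, which has parameter 0. As the apex points are pairwise distinct, its
        -- coefficient 1 survives.
        i : Fin (q ℕ.+ q)
        i = indexOf 𝔽.0# ↑ˡ q

      weight≤2q : weight x ≤ q ℕ.+ q
      weight≤2q = ℕ.≤-trans (minimal lineDifference lineDifference-dual lineDifference-nonZero)
        (cover⇒weight≤ lineDifference (apexPoint ∘ splitAt q) λ P P∈ →
          let i , _ , i∼P = pointCombination-supp (sign ∘ splitAt q) (apexPoint ∘ splitAt q) P P∈ in i , i∼P)

      module _ (B : ∀ j → ∃[ P ] P ∈supp x × proj₁ P ≋ basis j) where

        private
          b : Fin 4 → Point
          b j = proj₁ (B j)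
          b∈x : ∀ j → b j ∈supp x
          b∈x j = proj₁ (proj₂ (B j))
          b≋ : ∀ j → proj₁ (b j) ≋ basis j
          b≋ j = proj₂ (proj₂ (B j))

        b₁≁ : ∀ j → ¬ j ≡ 1F → ¬ b 1F ∼ b j
        b₁≁ j j≢1 (s , eq) = basis-≁ U (j≢1 ∘ ≡.sym) s λ i →
          𝔽.trans (𝔽.*-congˡ (𝔽.sym (b≋ 1F i))) (𝔽.trans (eq i) (b≋ j i))

        supportPointOn : ∀ j → ¬ j ≡ 1F → ∀ s →
          SupportPointIn (λ u w → u · basis 0F +[ w ] (basis j +[ s ] basis 1F))
        supportPointOn j j≢1 s = rebase
          (support-point-on-line (b j) (b 1F) (b 0F) (b∈x j) (b∈x 1F) (b∈x 0F) (b₁≁ j j≢1) s)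
          where
          rebase : SupportPointIn (λ u w → u · proj₁ (b 0F) +[ w ] (proj₁ (b j) +[ s ] proj₁ (b 1F))) →
                   SupportPointIn (λ u w → u · basis 0F +[ w ] (basis j +[ s ] basis 1F))
          rebase (P , P∈x , u , w , w≉0 , P≋) = P , P∈x , u , w , w≉0 , λ i → 𝔽.trans (P≋ i)
            (+[]-cong w (λ k → 𝔽.*-congˡ (b≋ 0F k)) (+[]-cong s (b≋ j) (b≋ 1F)) i)

        supportPoint : ∀ τ → SupportPointIn (λ u w → vector u w τ)
        supportPoint (inj₁ t) = supportPointOn 2F (λ ()) (element t)
        supportPoint (inj₂ t) = supportPointOn 3F (λ ()) (element t)

        distinct⇒2q<weight : (∀ τ → SupportPointIn (λ u w → vector u w τ)) → q ℕ.+ q < weight x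
        distinct⇒2q<weight Y = injection⇒≤weight x A A∈x A-injective
          where
          -- Prepending b₀ to the 2q points makes the inequality strict.
          A : Fin (suc (q ℕ.+ q)) → Point
          A zero    = b 0F
          A (suc i) = proj₁ (Y (splitAt q i))
          A∈x : ∀ i → A i ∈supp x
          A∈x zero    = b∈x 0F
          A∈x (suc i) = proj₁ (proj₂ (Y (splitAt q i)))
          b₀≁ : ∀ i → ¬ b 0F ∼ A (suc i)
          b₀≁ i (s , eq) = let _ , _ , u , w , w≉0 , P≋ = Y (splitAt q i) in
            vector≁basis₀ {u} {w} (splitAt q i) w≉0 s λ k →
              𝔽.trans (𝔽.*-congˡ (𝔽.sym (b≋ 0F k))) (𝔽.trans (eq k) (P≋ k))
          A-injective : ∀ i j → A i ∼ A j → i ≡ j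
          A-injective zero    zero    _  = ≡.refl
          A-injective zero    (suc j) eq = contradiction eq (b₀≁ j)
          A-injective (suc i) zero    eq = contradiction (∼-sym {A (suc i)} {b 0F} eq) (b₀≁ i)
          A-injective (suc i) (suc j) (s , eq) =
            let _ , _ , u , w , w≉0 , P≋ = Y (splitAt q i)
                _ , _ , u′ , w′ , w′≉0 , P′≋ = Y (splitAt q j)
            in ≡.cong suc (splitAt-injective q i j
                 (vector-injective {u} {w} {u′} {w′} (splitAt q i) (splitAt q j) w≉0 w′≉0 s λ k →
                   𝔽.trans (𝔽.*-congˡ (𝔽.sym (P≋ k))) (𝔽.trans (eq k) (P′≋ k))))

        2q<weight : q ℕ.+ q < weight x
        2q<weight = distinct⇒2q<weight supportPoint

    -- The basis consists of coordinate vectors of support points themselves, not of multiples,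
    -- which is what `extend` produces.
    SpannedBySupport : ∀ {k} → Subspace k → Set _
    SpannedBySupport U = ∀ j → ∃[ P ] P ∈supp x × proj₁ P ≋ Subspace.basis U j

    no-solid : (U : Subspace 4) → ¬ SpannedBySupport U
    no-solid U B = ℕ.<⇒≱ (2q<weight U B) (weight≤2q U)

    outside-or-contained : ∀ {k} (U : Subspace k) →
      (∃[ P ] P ∈supp x × ¬ P on U) ⊎ (∀ P → P ∈supp x → P on U)
    outside-or-contained U with Fin.any? (λ i → ¬? (suppPoint x i on? U))
    ... | yes (i , ¬on) = inj₁ (suppPoint x i , suppPoint-∈ x i , ¬on)
    ... | no  none      = inj₂ λ P P∈x →
      let i , P∼i = suppPoint-surjective x P P∈x in
      on-resp-∼ {P = suppPoint x i} {Q = P} U (∼-sym {P} {suppPoint x i} P∼i)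
        (decidable-stable (suppPoint x i on? U) (λ ¬on → none (i , ¬on)))

    ContainingPlane : Set _
    ContainingPlane = Σ Plane λ π → ∀ P → P ∈supp x → P on π

    -- A `Plane` needs three independent vectors, so a smaller span is padded with d arbitrary
    -- outside points; these exist because k < n + 1.
    enlarge : ∀ d {k} → d ℕ.+ k ≡ 3 → (U : Subspace k) → (∀ P → P ∈supp x → P on U) → ContainingPlane
    enlarge zero    ≡.refl U contained = U , contained
    enlarge (suc d) {k} d+k≡3 U contained =
      let Q , ¬on = outside U (s≤s (ℕ.≤-trans (ℕ.m≤n+m k (suc d)) (ℕ.≤-trans (ℕ.≤-reflexive d+k≡3) 3≤n)))
      in enlarge d (≡.trans (ℕ.+-suc d k) d+k≡3) (extend U Q ¬on) λ P P∈x →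
           let a , a≋P = contained P P∈x in
           (𝔽.0# ∷ a) , λ i → 𝔽.trans (𝔽.+-congʳ (𝔽.zeroˡ _)) (𝔽.trans (𝔽.+-identityˡ _) (a≋P i))

    -- Greedy choice of independent support points, d of three being still to be chosen. If three do
    -- not suffice, a fourth one contradicts `no-solid`.
    grow : ∀ d {k} → d ℕ.+ k ≡ 3 → (U : Subspace k) → SpannedBySupport U → ContainingPlane
    grow d {k} d+k≡3 U spanned with outside-or-contained U
    ... | inj₂ contained = enlarge d d+k≡3 U contained
    ... | inj₁ (P , P∈x , ¬on) = step d d+k≡3
      where
      spanned′ : SpannedBySupport (extend U P ¬on)
      spanned′ zero    = P , P∈x , λ _ → 𝔽.refl
      spanned′ (suc j) = spanned j
      step : ∀ d → d ℕ.+ k ≡ 3 → ContainingPlane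
      step zero    ≡.refl = contradiction spanned′ (no-solid (extend U P ¬on))
      step (suc d) d+k≡3  = grow d (≡.trans (ℕ.+-suc d k) d+k≡3) (extend U P ¬on) spanned′

    support-in-plane : ContainingPlane
    support-in-plane = grow 3 ≡.refl (record { basis = λ () ; independent = λ _ _ () }) λ ()

mainTheorem16 :
    ∀ {c ℓ₁ ℓ₂ c′ ℓ₁′ ℓ₂′ : Level}
    (n p h : ℕ) → 3 ≤ n → Prime p → 1 ≤ h →
    (F : FiniteField c ℓ₁ ℓ₂ (p ^ h)) →
    (K : FiniteField c′ ℓ₁′ ℓ₂′ p) →
    let open ProjectiveSpace F n
        open HyperplaneCode F n K
    in (x : Word) → IsMinimumWeightDualCodeword x →
       Σ Plane (λ π → ∀ P → P ∈supp x → P on π)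
mainTheorem16 n p h 3≤n _ 1≤h F K =
  MinimumWeight.support-in-plane F n K 3≤n (FieldProperties.q^h×1≈0 K 1≤h)
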